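{- Let $G$ be a weakly connected oriented graph on $n\ge 2$ vertices with $m\ge 1$ edges and non-zero edge weights in $\mathbb{C}\setminus\mathbb{R}^-$ such that $wt(C)\in\mathbb{R}^+$ for all even cycles $C$ of $G$. Let $u,v\in V(G)$. If $\gamma_1$ and $\gamma_2$ are both shortest walks from $u$ to $v$ in $G_u$, then $$\frac{wt(\gamma_1)}{|wt(\gamma_1)|}=\frac{wt(\gamma_2)}{|wt(\gamma_2)|}.$$
   Context: An oriented graph $G$ is obtained from a finite simple undirected graph $G_u$ (its underlying graph) by giving each edge exactly one direction; it is weakly connected if $G_u$ is connected. Each directed edge $(u,v)$ (from $u$ to $v$) has a non-zero complex weight $w_{uv}$. $\mathbb{R}^+$ and $\mathbb{R}^-$ denote the positive and the negative real numbers. Put $a_{ij}=w_{ij}$ if $(i,j)\in E(G)$, $a_{ij}=\overline{w_{ji}}$ if $(j,i)\in E(G)$, and $a_{ij}=0$ otherwise. The weight of a walk $\gamma=(i_1,\dots,i_k)$ in $G_u$ is $wt(\gamma)=\prod_{s=1}^{k-1}a_{i_si_{s+1}}$ (so a trivial one-vertex walk has weight $1$). A cycle of $G$ means a cycle of $G_u$; $wt(C)$ is the weight of the closed walk going once around $C$ in either direction (the two directions give complex conjugate values, so the condition $wt(C)\in\mathbb{R}^+$ does not depend on the choice). -}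

module Defs where

open import Data.Fin.Base using (Fin)
import Data.Integer.Base as ℤ
import Data.Integer.Properties as ℤₚ
open import Data.List.Base using (List; []; _∷_; length; filter; allFin; cartesianProduct)
open import Data.List.Relation.Unary.Unique.Propositional using (Unique)
open import Data.Nat.Base as ℕ using (ℕ; zero; suc)
open import Data.Nat.Coprimality as Coprimality using (1-coprimeTo)
import Data.Nat.Properties as ℕₚ
open import Data.Product.Base using (∃; _×_; _,_)
open import Data.Rational.Base
open import Data.Rational.Properties
open import Data.Rational.Solver using (module +-*-Solver)
open import Data.Sum.Base using (_⊎_; inj₁; inj₂)
open import Level using (0ℓ)
open import Relation.Binary.Construct.Closure.ReflexiveTransitive as Star using (Star; _◅_)
open import Relation.Binary.Core using (Rel)
open import Relation.Binary.Definitions using (Asymmetric; Decidable)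
open import Relation.Binary.PropositionalEquality
open import Relation.Nullary using (¬_; yes; no; contradiction)

module Rat where

  open +-*-Solver

  ½-sum : ∀ p → p * ½ + p * ½ ≡ p
  ½-sum = solve 1 (λ p → p :* con ½ :+ p :* con ½ := p) refl

  0<½* : ∀ {p} → 0ℚ < p → 0ℚ < p * ½
  0<½* {p} 0<p = subst (_< p * ½) (*-zeroˡ ½) (*-monoˡ-<-pos ½ 0<p)

  ½*< : ∀ {p} → 0ℚ < p → p * ½ < p
  ½*< {p} 0<p = subst₂ _<_ (+-identityʳ (p * ½)) (½-sum p) (+-monoʳ-< (p * ½) (0<½* 0<p))

  0<* : ∀ {p q} → 0ℚ < p → 0ℚ < q → 0ℚ < p * q
  0<* {p} {q} 0<p 0<q =
    subst (_< p * q) (*-zeroˡ q) (*-monoˡ-<-pos q {{positive 0<q}} 0<p)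

  0<+ : ∀ {p q} → 0ℚ ≤ p → 0ℚ < q → 0ℚ < p + q
  0<+ {p} {q} 0≤p 0<q =
    subst (_< p + q) (+-identityʳ 0ℚ) (+-mono-≤-< {0ℚ} {p} {0ℚ} {q} 0≤p 0<q)

  0≤+ : ∀ {p q} → 0ℚ ≤ p → 0ℚ ≤ q → 0ℚ ≤ p + q
  0≤+ {p} {q} 0≤p 0≤q =
    subst (_≤ p + q) (+-identityʳ 0ℚ) (+-mono-≤ {0ℚ} {p} {0ℚ} {q} 0≤p 0≤q)

  0≤* : ∀ {p q} → 0ℚ ≤ p → 0ℚ ≤ q → 0ℚ ≤ p * q
  0≤* {p} {q} 0≤p 0≤q =
    subst (_≤ p * q) (*-zeroˡ q) (*-monoʳ-≤-nonNeg q {{nonNegative 0≤q}} 0≤p)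

  *-mono-≤ : ∀ {p q r s} → 0ℚ ≤ r → 0ℚ ≤ q → p ≤ q → r ≤ s → p * r ≤ q * s
  *-mono-≤ {p} {q} {r} {s} 0≤r 0≤q p≤q r≤s = ≤-trans
    (*-monoʳ-≤-nonNeg r {{nonNegative 0≤r}} p≤q)
    (*-monoˡ-≤-nonNeg q {{nonNegative 0≤q}} r≤s)

  0<⊓ : ∀ {p q} → 0ℚ < p → 0ℚ < q → 0ℚ < p ⊓ q
  0<⊓ {p} {q} 0<p 0<q with ≤-total p q
  ... | inj₁ p≤q = subst (0ℚ <_) (sym (p≤q⇒p⊓q≡p p≤q)) 0<p
  ... | inj₂ q≤p = subst (0ℚ <_) (sym (p≥q⇒p⊓q≡q q≤p)) 0<q

  square-≤⇒≤ : ∀ {p q} → 0ℚ ≤ q → p * p ≤ q * q → p ≤ q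
  square-≤⇒≤ {p} {q} 0≤q pp≤qq with p ≤? q
  ... | yes p≤q = p≤q
  ... | no  p≰q = contradiction pp≤qq (<⇒≱ (≤-<-trans
          (*-monoˡ-≤-nonNeg q {{nonNegative 0≤q}} (<⇒≤ q<p))
          (*-monoˡ-<-pos p {{positive (≤-<-trans 0≤q q<p)}} q<p)))
    where
    q<p = ≰⇒> p≰q
    <⇒≱ : ∀ {a b} → a < b → ¬ (b ≤ a)
    <⇒≱ a<b b≤a = <-irrefl refl (<-≤-trans a<b b≤a)

  p≤∣p∣ : ∀ p → p ≤ ∣ p ∣
  p≤∣p∣ p with ≤-total 0ℚ p
  ... | inj₁ 0≤p = ≤-reflexive (sym (0≤p⇒∣p∣≡p 0≤p))
  ... | inj₂ p≤0 = ≤-trans p≤0 (0≤∣p∣ p)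

  p*p≡∣p∣*∣p∣ : ∀ p → p * p ≡ ∣ p ∣ * ∣ p ∣
  p*p≡∣p∣*∣p∣ p with ∣p∣≡p∨∣p∣≡-p p
  ... | inj₁ eq = sym (cong₂ _*_ eq eq)
  ... | inj₂ eq = trans
    (solve 1 (λ p → p :* p := (:- p) :* (:- p)) refl p) (sym (cong₂ _*_ eq eq))

  0≤p*p : ∀ p → 0ℚ ≤ p * p
  0≤p*p p = subst (0ℚ ≤_) (sym (p*p≡∣p∣*∣p∣ p)) (0≤* (0≤∣p∣ p) (0≤∣p∣ p))

  ∣p-q∣≡∣q-p∣ : ∀ p q → ∣ p - q ∣ ≡ ∣ q - p ∣
  ∣p-q∣≡∣q-p∣ p q = trans (sym (∣-p∣≡∣p∣ (p - q)))
    (cong ∣_∣ (solve 2 (λ p q → :- (p :- q) := q :- p) refl p q))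

  ∣-∣-< : ∀ {p q} → p < q → - p < q → ∣ p ∣ < q
  ∣-∣-< {p} {q} p<q -p<q with ∣p∣≡p∨∣p∣≡-p p
  ... | inj₁ eq = subst (_< q) (sym eq) p<q
  ... | inj₂ eq = subst (_< q) (sym eq) -p<q

  ι : ℕ → ℚ
  ι k = mkℚ (ℤ.+ k) 0 (Coprimality.sym (1-coprimeTo k))

  -- 1 / (n + 1)
  δ : ℕ → ℚ
  δ n = mkℚ (ℤ.+ 1) n (1-coprimeTo (suc n))

  0<δ : ∀ n → 0ℚ < δ n
  0<δ n = positive⁻¹ (δ n)

  0≤ι : ∀ k → 0ℚ ≤ ι k
  0≤ι k = nonNegative⁻¹ (ι k)

  ι-suc : ∀ k → ι (suc k) ≡ ι k + 1ℚ
  ι-suc k = sym (trans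
    (cong (_/ 1) (trans (cong (ℤ._+ ℤ.+ 1) (ℤₚ.*-identityʳ (ℤ.+ k)))
                        (cong ℤ.+_ (ℕₚ.+-comm k 1))))
    (normalize-coprime (Coprimality.sym (1-coprimeTo (suc k)))))

  ι-+ : ∀ j k → ι (j ℕ.+ k) ≡ ι j + ι k
  ι-+ zero    k = sym (+-identityˡ (ι k))
  ι-+ (suc j) k = begin
    ι (suc (j ℕ.+ k))    ≡⟨ ι-suc (j ℕ.+ k) ⟩
    ι (j ℕ.+ k) + 1ℚ     ≡⟨ cong (_+ 1ℚ) (ι-+ j k) ⟩
    ι j + ι k + 1ℚ       ≡⟨ solve 2 (λ j k → j :+ k :+ con 1ℚ := j :+ con 1ℚ :+ k) refl (ι j) (ι k) ⟩
    ι j + 1ℚ + ι k       ≡⟨ cong (_+ ι k) (sym (ι-suc j)) ⟩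
    ι (suc j) + ι k      ∎
    where open ≡-Reasoning

  ι-* : ∀ j k → ι (j ℕ.* k) ≡ ι j * ι k
  ι-* zero    k = sym (*-zeroˡ (ι k))
  ι-* (suc j) k = begin
    ι (k ℕ.+ j ℕ.* k)    ≡⟨ ι-+ k (j ℕ.* k) ⟩
    ι k + ι (j ℕ.* k)    ≡⟨ cong (ι k +_) (ι-* j k) ⟩
    ι k + ι j * ι k      ≡⟨ solve 2 (λ j k → k :+ j :* k := (j :+ con 1ℚ) :* k) refl (ι j) (ι k) ⟩
    (ι j + 1ℚ) * ι k     ≡⟨ cong (_* ι k) (sym (ι-suc j)) ⟩
    ι (suc j) * ι k      ∎
    where open ≡-Reasoning

  δ*ι : ∀ n → δ n * ι (suc n) ≡ 1ℚ
  δ*ι n = *-inverseˡ (ι (suc n))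

  ⌈_⌉⁺ : ℚ → ℕ
  ⌈ p ⌉⁺ = suc ℤ.∣ ↥ p ∣

  p≤ι⌈p⌉⁺ : ∀ p → p ≤ ι ⌈ p ⌉⁺
  p≤ι⌈p⌉⁺ p@(mkℚ n d _) = *≤* (begin
    n ℤ.* ℤ.+ 1                          ≡⟨ ℤₚ.*-identityʳ n ⟩
    n                                    ≤⟨ i≤∣i∣ n ⟩
    ℤ.+ ℤ.∣ n ∣                          ≤⟨ ℤ.+≤+ (ℕₚ.≤-trans (ℕₚ.n≤1+n ℤ.∣ n ∣) (ℕₚ.m≤m*n (suc ℤ.∣ n ∣) (suc d))) ⟩
    ℤ.+ (suc ℤ.∣ n ∣ ℕ.* suc d)          ∎)
    where
    open ℤₚ.≤-Reasoning
    i≤∣i∣ : ∀ i → i ℤ.≤ ℤ.+ ℤ.∣ i ∣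
    i≤∣i∣ (ℤ.+ n)     = ℤₚ.≤-refl
    i≤∣i∣ ℤ.-[1+ n ]  = ℤ.-≤+

  δ-anti : ∀ {m n} → m ℕ.≤ n → δ n ≤ δ m
  δ-anti {m} {n} m≤n = *≤* (ℤ.+≤+ (ℕₚ.*-monoʳ-≤ 1 (ℕ.s≤s m≤n)))

  δ-small : ∀ {p} → 0ℚ < p → ∃ λ N → ∀ n → N ℕ.≤ n → δ n ≤ p
  δ-small {mkℚ (ℤ.+ suc k) d c} 0<p =
    d , λ n d≤n → ≤-trans (δ-anti d≤n)
      (*≤* (ℤ.+≤+ (ℕₚ.*-monoˡ-≤ (suc d) {1} {suc k} (ℕ.s≤s ℕ.z≤n))))
  δ-small {mkℚ (ℤ.+ 0) d c} (*<* (ℤ.+<+ ()))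
  δ-small {mkℚ ℤ.-[1+ k ] d c} (*<* ())

open Rat using (δ; ⌈_⌉⁺)

-- Real numbers: Cauchy sequences of rationals (with modulus of
-- convergence), up to the setoid equality _≈ℝ_.

Cauchy : (ℕ → ℚ) → Set
Cauchy x = ∀ ε → 0ℚ < ε → ∃ λ N → ∀ m n → N ℕ.≤ m → N ℕ.≤ n → ∣ x m - x n ∣ < ε

record ℝ : Set where
  constructor mkℝ
  field
    seq    : ℕ → ℚ
    cauchy : Cauchy seq

open ℝ public

fromℚ : ℚ → ℝ
fromℚ p = mkℝ (λ _ → p) λ ε 0<ε → 0 , λ _ _ _ _ →
  subst (λ z → ∣ z ∣ < ε) (sym (+-inverseʳ p)) 0<ε

0ℝ 1ℝ : ℝ
0ℝ = fromℚ 0ℚ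
1ℝ = fromℚ 1ℚ

infix 4 _≈ℝ_ _<ℝ_ _#ℝ_

_≈ℝ_ : Rel ℝ 0ℓ
x ≈ℝ y = ∀ ε → 0ℚ < ε → ∃ λ N → ∀ n → N ℕ.≤ n → ∣ seq x n - seq y n ∣ < ε

_<ℝ_ : Rel ℝ 0ℓ
x <ℝ y = ∃ λ ε → 0ℚ < ε × ∃ λ N → ∀ n → N ℕ.≤ n → seq x n + ε ≤ seq y n

-- Constructive inequality of reals (classically the negation of _≈ℝ_).
_#ℝ_ : Rel ℝ 0ℓ
x #ℝ y = x <ℝ y ⊎ y <ℝ x

-- The junk value at 0 occurs at most finitely often when invℝ applies this
-- to a sequence apart from 0.
recip : ℚ → ℚ
recip p with p ≟ 0ℚ
... | yes _   = 0ℚ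
... | no  p≢0 = (1/ p) {{≢-nonZero p≢0}}

-- sqrtStep iterated k times from 0 gives the largest j·d with j ≤ k and
-- (j·d)² ≤ q (or 0 when q < 0).
sqrtStep : (d q s : ℚ) → ℚ
sqrtStep d q s with (s + d) * (s + d) ≤? q
... | yes _ = s + d
... | no  _ = s

sqrtSearch : (d q : ℚ) → ℕ → ℚ
sqrtSearch d q zero    = 0ℚ
sqrtSearch d q (suc k) = sqrtStep d q (sqrtSearch d q k)

-- √(max q 0) rounded down to a multiple of 1 / (n + 1).
sqrtApprox : ℕ → ℚ → ℚ
sqrtApprox n q = sqrtSearch (δ n) q (⌈ q ⌉⁺ ℕ.* suc n)

module RealProofs where

  open Rat
  open +-*-Solver

  +-cauchy : ∀ {x y} → Cauchy x → Cauchy y → Cauchy (λ n → x n + y n)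
  +-cauchy {x} {y} cx cy ε 0<ε
    with cx (ε * ½) (0<½* 0<ε) | cy (ε * ½) (0<½* 0<ε)
  ... | N , p | M , q = N ℕ.⊔ M , λ m n N≤m N≤n → begin-strict
    ∣ x m + y m - (x n + y n) ∣
      ≡⟨ cong ∣_∣ (solve 4 (λ a b c d → a :+ b :- (c :+ d) := (a :- c) :+ (b :- d)) refl (x m) (y m) (x n) (y n)) ⟩
    ∣ (x m - x n) + (y m - y n) ∣
      ≤⟨ ∣p+q∣≤∣p∣+∣q∣ (x m - x n) (y m - y n) ⟩
    ∣ x m - x n ∣ + ∣ y m - y n ∣
      <⟨ +-mono-< (p m n (ℕₚ.m⊔n≤o⇒m≤o N M N≤m) (ℕₚ.m⊔n≤o⇒m≤o N M N≤n))
                  (q m n (ℕₚ.m⊔n≤o⇒n≤o N M N≤m) (ℕₚ.m⊔n≤o⇒n≤o N M N≤n)) ⟩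
    ε * ½ + ε * ½
      ≡⟨ ½-sum ε ⟩
    ε ∎
    where open ≤-Reasoning

  neg-cauchy : ∀ {x} → Cauchy x → Cauchy (λ n → - x n)
  neg-cauchy {x} cx ε 0<ε with cx ε 0<ε
  ... | N , p = N , λ m n N≤m N≤n → subst (_< ε)
    (trans (sym (∣-p∣≡∣p∣ (x m - x n)))
           (cong ∣_∣ (solve 2 (λ a b → :- (a :- b) := :- a :- (:- b)) refl (x m) (x n))))
    (p m n N≤m N≤n)

  Bounded : (ℕ → ℚ) → Set
  Bounded x = ∃ λ B → 0ℚ < B × ∃ λ N → ∀ n → N ℕ.≤ n → ∣ x n ∣ ≤ B

  bounded : ∀ {x} → Cauchy x → Bounded x
  bounded {x} cx with cx 1ℚ (positive⁻¹ 1ℚ)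
  ... | N , p = 1ℚ + ∣ x N ∣
    , <-≤-trans (positive⁻¹ 1ℚ) (subst (_≤ 1ℚ + ∣ x N ∣) (+-identityʳ 1ℚ) (+-monoʳ-≤ 1ℚ (0≤∣p∣ (x N))))
    , N , λ n N≤n → begin
      ∣ x n ∣                  ≡⟨ cong ∣_∣ (solve 2 (λ a b → a := (a :- b) :+ b) refl (x n) (x N)) ⟩
      ∣ (x n - x N) + x N ∣    ≤⟨ ∣p+q∣≤∣p∣+∣q∣ (x n - x N) (x N) ⟩
      ∣ x n - x N ∣ + ∣ x N ∣  ≤⟨ +-monoˡ-≤ ∣ x N ∣ (<⇒≤ (p n N N≤n ℕₚ.≤-refl)) ⟩
      1ℚ + ∣ x N ∣             ∎
    where open ≤-Reasoning

  scaled : ∀ {x} B → 0ℚ < B →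
    (∀ ε → 0ℚ < ε → ∃ λ N → ∀ m n → N ℕ.≤ m → N ℕ.≤ n → ∣ x m - x n ∣ < B * ε) → Cauchy x
  scaled {x} B 0<B h ε 0<ε = subst (λ e → ∃ λ N → ∀ m n → N ℕ.≤ m → N ℕ.≤ n → ∣ x m - x n ∣ < e)
    B*[B⁻¹*ε]≡ε (h (B⁻¹ * ε) (0<* (positive⁻¹ B⁻¹ {{1/pos⇒pos B {{positive 0<B}}}}) 0<ε))
    where
    B⁻¹ : ℚ
    B⁻¹ = (1/ B) {{>-nonZero 0<B}}
    B*[B⁻¹*ε]≡ε : B * (B⁻¹ * ε) ≡ ε
    B*[B⁻¹*ε]≡ε = trans (sym (*-assoc B B⁻¹ ε))
      (trans (cong (_* ε) (*-inverseʳ B {{>-nonZero 0<B}})) (*-identityˡ ε))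

  *-diff : ∀ a b c d → a * b - c * d ≡ a * (b - d) + d * (a - c)
  *-diff = solve 4 (λ a b c d → a :* b :- c :* d := a :* (b :- d) :+ d :* (a :- c)) refl

  *-close : ∀ {a b c d B C ε} → 0ℚ < B → 0ℚ < C → ∣ a ∣ ≤ B → ∣ d ∣ ≤ C →
    ∣ a - c ∣ < ε → ∣ b - d ∣ < ε → ∣ a * b - c * d ∣ < (B + C) * ε
  *-close {a} {b} {c} {d} {B} {C} {ε} 0<B 0<C a≤B d≤C ac<ε bd<ε = begin-strict
    ∣ a * b - c * d ∣
      ≡⟨ cong ∣_∣ (*-diff a b c d) ⟩
    ∣ a * (b - d) + d * (a - c) ∣
      ≤⟨ ∣p+q∣≤∣p∣+∣q∣ (a * (b - d)) (d * (a - c)) ⟩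
    ∣ a * (b - d) ∣ + ∣ d * (a - c) ∣
      ≡⟨ cong₂ _+_ (∣p*q∣≡∣p∣*∣q∣ a (b - d)) (∣p*q∣≡∣p∣*∣q∣ d (a - c)) ⟩
    ∣ a ∣ * ∣ b - d ∣ + ∣ d ∣ * ∣ a - c ∣
      ≤⟨ +-mono-≤ (*-monoʳ-≤-nonNeg ∣ b - d ∣ {{∣-∣-nonNeg (b - d)}} a≤B)
                  (*-monoʳ-≤-nonNeg ∣ a - c ∣ {{∣-∣-nonNeg (a - c)}} d≤C) ⟩
    B * ∣ b - d ∣ + C * ∣ a - c ∣
      <⟨ +-mono-< (*-monoʳ-<-pos B {{positive 0<B}} bd<ε) (*-monoʳ-<-pos C {{positive 0<C}} ac<ε) ⟩
    B * ε + C * ε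
      ≡⟨ sym (*-distribʳ-+ ε B C) ⟩
    (B + C) * ε ∎
    where open ≤-Reasoning

  *-cauchy′ : ∀ {x y} → Bounded x → Bounded y → Cauchy x → Cauchy y → Cauchy (λ n → x n * y n)
  *-cauchy′ {x} {y} (B , 0<B , N₁ , b) (C , 0<C , N₂ , c) cx cy =
    scaled {λ n → x n * y n} (B + C) (0<+ (<⇒≤ 0<B) 0<C) main
    where
    main : ∀ ε → 0ℚ < ε → ∃ λ N → ∀ m n → N ℕ.≤ m → N ℕ.≤ n → ∣ x m * y m - x n * y n ∣ < (B + C) * ε
    main ε 0<ε with cx ε 0<ε | cy ε 0<ε
    ... | N₃ , p | N₄ , q = (N₁ ℕ.⊔ N₂) ℕ.⊔ (N₃ ℕ.⊔ N₄) , body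
      where
      body : ∀ m n → (N₁ ℕ.⊔ N₂) ℕ.⊔ (N₃ ℕ.⊔ N₄) ℕ.≤ m → (N₁ ℕ.⊔ N₂) ℕ.⊔ (N₃ ℕ.⊔ N₄) ℕ.≤ n →
             ∣ x m * y m - x n * y n ∣ < (B + C) * ε
      body m n N≤m N≤n = *-close {x m} {y m} {x n} {y n} 0<B 0<C
        (b m (ℕₚ.m⊔n≤o⇒m≤o N₁ N₂ (ℕₚ.m⊔n≤o⇒m≤o (N₁ ℕ.⊔ N₂) (N₃ ℕ.⊔ N₄) N≤m)))
        (c n (ℕₚ.m⊔n≤o⇒n≤o N₁ N₂ (ℕₚ.m⊔n≤o⇒m≤o (N₁ ℕ.⊔ N₂) (N₃ ℕ.⊔ N₄) N≤n)))
        (p m n (ℕₚ.m⊔n≤o⇒m≤o N₃ N₄ N₃₄≤m) (ℕₚ.m⊔n≤o⇒m≤o N₃ N₄ N₃₄≤n))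
        (q m n (ℕₚ.m⊔n≤o⇒n≤o N₃ N₄ N₃₄≤m) (ℕₚ.m⊔n≤o⇒n≤o N₃ N₄ N₃₄≤n))
        where
        N₃₄≤m = ℕₚ.m⊔n≤o⇒n≤o (N₁ ℕ.⊔ N₂) (N₃ ℕ.⊔ N₄) N≤m
        N₃₄≤n = ℕₚ.m⊔n≤o⇒n≤o (N₁ ℕ.⊔ N₂) (N₃ ℕ.⊔ N₄) N≤n

  *-cauchy : ∀ {x y} → Cauchy x → Cauchy y → Cauchy (λ n → x n * y n)
  *-cauchy {x} {y} cx cy = *-cauchy′ (bounded {x} cx) (bounded {y} cy) cx cy

  recip-inverse : ∀ p → p ≢ 0ℚ → recip p * p ≡ 1ℚ
  recip-inverse p p≢0 with p ≟ 0ℚ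
  ... | yes p≡0 = contradiction p≡0 p≢0
  ... | no  p≢0 = *-inverseˡ p {{≢-nonZero p≢0}}

  away-from-0 : ∀ {x} → x #ℝ 0ℝ →
    ∃ λ d → 0ℚ < d × ∃ λ N → ∀ n → N ℕ.≤ n → d ≤ ∣ seq x n ∣
  away-from-0 {x} (inj₁ (d , 0<d , N , h)) = d , 0<d , N , λ n N≤n → begin
    d                     ≡⟨ solve 2 (λ a d → d := :- a :+ (a :+ d)) refl (seq x n) d ⟩
    - seq x n + (seq x n + d) ≤⟨ +-monoʳ-≤ (- seq x n) (h n N≤n) ⟩
    - seq x n + 0ℚ        ≡⟨ +-identityʳ (- seq x n) ⟩
    - seq x n             ≤⟨ p≤∣p∣ (- seq x n) ⟩
    ∣ - seq x n ∣         ≡⟨ ∣-p∣≡∣p∣ (seq x n) ⟩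
    ∣ seq x n ∣           ∎
    where open ≤-Reasoning
  away-from-0 {x} (inj₂ (d , 0<d , N , h)) = d , 0<d , N , λ n N≤n → begin
    d                     ≡⟨ sym (+-identityˡ d) ⟩
    0ℚ + d                ≤⟨ h n N≤n ⟩
    seq x n               ≤⟨ p≤∣p∣ (seq x n) ⟩
    ∣ seq x n ∣           ∎
    where open ≤-Reasoning

  recip-diff : ∀ a b r s → r * (s * b) - s * (r * a) ≡ - ((r * s) * (a - b))
  recip-diff = solve 4 (λ a b r s → r :* (s :* b) :- s :* (r :* a) := :- ((r :* s) :* (a :- b))) refl

  recip-close : ∀ {a b r s B ε} → 0ℚ < B → r * a ≡ 1ℚ → s * b ≡ 1ℚ → ∣ r ∣ ≤ B → ∣ s ∣ ≤ B →
    ∣ a - b ∣ < ε → ∣ r - s ∣ < (B * B) * ε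
  recip-close {a} {b} {r} {s} {B} {ε} 0<B ra≡1 sb≡1 r≤B s≤B ab<ε = begin-strict
    ∣ r - s ∣
      ≡⟨ cong₂ (λ p q → ∣ p - q ∣) (sym (trans (cong (r *_) sb≡1) (*-identityʳ r)))
                                   (sym (trans (cong (s *_) ra≡1) (*-identityʳ s))) ⟩
    ∣ r * (s * b) - s * (r * a) ∣
      ≡⟨ cong ∣_∣ (recip-diff a b r s) ⟩
    ∣ - ((r * s) * (a - b)) ∣
      ≡⟨ ∣-p∣≡∣p∣ ((r * s) * (a - b)) ⟩
    ∣ (r * s) * (a - b) ∣
      ≡⟨ trans (∣p*q∣≡∣p∣*∣q∣ (r * s) (a - b)) (cong (_* ∣ a - b ∣) (∣p*q∣≡∣p∣*∣q∣ r s)) ⟩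
    (∣ r ∣ * ∣ s ∣) * ∣ a - b ∣
      ≤⟨ *-monoʳ-≤-nonNeg ∣ a - b ∣ {{∣-∣-nonNeg (a - b)}}
           (*-mono-≤ (0≤∣p∣ s) (<⇒≤ 0<B) r≤B s≤B) ⟩
    (B * B) * ∣ a - b ∣
      <⟨ *-monoʳ-<-pos (B * B) {{positive (0<* 0<B 0<B)}} ab<ε ⟩
    (B * B) * ε ∎
    where open ≤-Reasoning

  recip-cauchy : ∀ {x} → Cauchy x →
    (∃ λ d → 0ℚ < d × ∃ λ N → ∀ n → N ℕ.≤ n → d ≤ ∣ x n ∣) → Cauchy (λ n → recip (x n))
  recip-cauchy {x} cx (d , 0<d , N₁ , h) = scaled {λ n → recip (x n)} (B * B) (0<* 0<B 0<B) main
    where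
    open ≤-Reasoning
    B : ℚ
    B = (1/ d) {{>-nonZero 0<d}}
    0<B : 0ℚ < B
    0<B = positive⁻¹ B {{1/pos⇒pos d {{positive 0<d}}}}
    inverse : ∀ n → N₁ ℕ.≤ n → recip (x n) * x n ≡ 1ℚ
    inverse n N≤n = recip-inverse (x n)
      (λ eq → <-irrefl refl (<-≤-trans 0<d (subst (λ z → d ≤ ∣ z ∣) eq (h n N≤n))))
    r≤B : ∀ n → N₁ ℕ.≤ n → ∣ recip (x n) ∣ ≤ B
    r≤B n N≤n = *-cancelʳ-≤-pos d {{positive 0<d}} (begin
      ∣ recip (x n) ∣ * d          ≤⟨ *-monoˡ-≤-nonNeg ∣ recip (x n) ∣ {{∣-∣-nonNeg (recip (x n))}} (h n N≤n) ⟩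
      ∣ recip (x n) ∣ * ∣ x n ∣    ≡⟨ sym (∣p*q∣≡∣p∣*∣q∣ (recip (x n)) (x n)) ⟩
      ∣ recip (x n) * x n ∣        ≡⟨ cong ∣_∣ (inverse n N≤n) ⟩
      1ℚ                           ≡⟨ sym (*-inverseˡ d {{>-nonZero 0<d}}) ⟩
      B * d                        ∎)
    main : ∀ ε → 0ℚ < ε → ∃ λ N → ∀ m n → N ℕ.≤ m → N ℕ.≤ n → ∣ recip (x m) - recip (x n) ∣ < (B * B) * ε
    main ε 0<ε with cx ε 0<ε
    ... | N₂ , p = N₁ ℕ.⊔ N₂ , body
      where
      body : ∀ m n → N₁ ℕ.⊔ N₂ ℕ.≤ m → N₁ ℕ.⊔ N₂ ℕ.≤ n → ∣ recip (x m) - recip (x n) ∣ < (B * B) * ε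
      body m n N≤m N≤n = recip-close {x m} {x n} 0<B
        (inverse m N₁≤m) (inverse n N₁≤n) (r≤B m N₁≤m) (r≤B n N₁≤n)
        (p m n (ℕₚ.m⊔n≤o⇒n≤o N₁ N₂ N≤m) (ℕₚ.m⊔n≤o⇒n≤o N₁ N₂ N≤n))
        where
        N₁≤m = ℕₚ.m⊔n≤o⇒m≤o N₁ N₂ N≤m
        N₁≤n = ℕₚ.m⊔n≤o⇒m≤o N₁ N₂ N≤n

  module _ (d q : ℚ) (0<d : 0ℚ < d) where

    private
      0≤d = <⇒≤ 0<d

    search-nonNeg : ∀ k → 0ℚ ≤ sqrtSearch d q k
    search-nonNeg zero    = ≤-refl
    search-nonNeg (suc k) with (sqrtSearch d q k + d) * (sqrtSearch d q k + d) ≤? q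
    ... | yes _ = 0≤+ (search-nonNeg k) 0≤d
    ... | no  _ = search-nonNeg k

    search-lower : ∀ k → sqrtSearch d q k ≡ 0ℚ ⊎ sqrtSearch d q k * sqrtSearch d q k ≤ q
    search-lower zero    = inj₁ refl
    search-lower (suc k) with (sqrtSearch d q k + d) * (sqrtSearch d q k + d) ≤? q
    ... | yes le = inj₂ le
    ... | no  _  = search-lower k

    search-upper : ∀ k → q < (sqrtSearch d q k + d) * (sqrtSearch d q k + d)
                       ⊎ sqrtSearch d q k ≡ ι k * d
    search-upper zero    = inj₂ (sym (*-zeroˡ d))
    search-upper (suc k) with (sqrtSearch d q k + d) * (sqrtSearch d q k + d) ≤? q | search-upper k
    ... | no  gt | _       = inj₁ (≰⇒> gt)
    ... | yes le | inj₁ gt = contradiction (<-≤-trans gt le) (<-irrefl refl)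
    ... | yes le | inj₂ eq = inj₂ (begin
      sqrtSearch d q k + d  ≡⟨ cong (_+ d) eq ⟩
      ι k * d + d           ≡⟨ solve 2 (λ k d → k :* d :+ d := (k :+ con 1ℚ) :* d) refl (ι k) d ⟩
      (ι k + 1ℚ) * d        ≡⟨ cong (_* d) (sym (ι-suc k)) ⟩
      ι (suc k) * d         ∎)
      where open ≡-Reasoning

  sqrtApprox-nonNeg : ∀ n q → 0ℚ ≤ sqrtApprox n q
  sqrtApprox-nonNeg n q = search-nonNeg (δ n) q (0<δ n) (⌈ q ⌉⁺ ℕ.* suc n)

  sqrtApprox-lower : ∀ n q → sqrtApprox n q ≡ 0ℚ ⊎ sqrtApprox n q * sqrtApprox n q ≤ q
  sqrtApprox-lower n q = search-lower (δ n) q (0<δ n) (⌈ q ⌉⁺ ℕ.* suc n)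

  sqrtApprox-upper : ∀ n q → q < (sqrtApprox n q + δ n) * (sqrtApprox n q + δ n)
  sqrtApprox-upper n q with search-upper (δ n) q (0<δ n) (⌈ q ⌉⁺ ℕ.* suc n)
  ... | inj₁ gt = gt
  ... | inj₂ eq = begin-strict
    q                      ≤⟨ p≤ι⌈p⌉⁺ q ⟩
    K                      ≡⟨ sym (*-identityʳ K) ⟩
    K * 1ℚ                 ≤⟨ *-monoˡ-≤-nonNeg K {{nonNegative (0≤ι ⌈ q ⌉⁺)}} 1≤K ⟩
    K * K                  ≤⟨ *-monoˡ-≤-nonNeg K {{nonNegative (0≤ι ⌈ q ⌉⁺)}} (<⇒≤ K<s+δ) ⟩
    K * (s + δ n)          <⟨ *-monoˡ-<-pos (s + δ n) {{positive (≤-<-trans (0≤ι ⌈ q ⌉⁺) K<s+δ)}} K<s+δ ⟩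
    (s + δ n) * (s + δ n)  ∎
    where
    open ≤-Reasoning
    K = ι ⌈ q ⌉⁺
    s = sqrtApprox n q
    1≤K : 1ℚ ≤ K
    1≤K = subst₂ _≤_ (+-identityˡ 1ℚ) (sym (ι-suc ℤ.∣ ↥ q ∣)) (+-monoˡ-≤ 1ℚ (0≤ι ℤ.∣ ↥ q ∣))
    s≡K : s ≡ K
    s≡K = trans eq (trans (cong (_* δ n) (ι-* ⌈ q ⌉⁺ (suc n)))
      (trans (*-assoc K (ι (suc n)) (δ n))
        (trans (cong (K *_) (trans (*-comm (ι (suc n)) (δ n)) (δ*ι n))) (*-identityʳ K))))
    K<s+δ : K < s + δ n
    K<s+δ = subst₂ _<_ (+-identityʳ K) (cong (_+ δ n) (sym s≡K)) (+-monoʳ-< K (0<δ n))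

  -- If q and q′ are within (ε/2)² of each other and 1 / (n + 1) ≤ ε/2,
  -- then the approximate roots satisfy s < s′ + ε.
  sqrtApprox-close : ∀ {ε} → 0ℚ < ε → ∀ m n q q′ → δ n ≤ ε * ½ →
    ∣ q - q′ ∣ < (ε * ½) * (ε * ½) → sqrtApprox m q - sqrtApprox n q′ < ε
  sqrtApprox-close {ε} 0<ε m n q q′ δ≤ q-q′<
    with sqrtApprox m q - sqrtApprox n q′ <? ε
  ... | yes lt = lt
  ... | no ge = contradiction q<q (<-irrefl refl)
    where
    open ≤-Reasoning
    h = ε * ½
    s = sqrtApprox m q
    t = sqrtApprox n q′
    0<h = 0<½* 0<ε
    0≤t = sqrtApprox-nonNeg n q′
    t+ε≤s : t + ε ≤ s
    t+ε≤s = subst (t + ε ≤_) (solve 2 (λ s t → t :+ (s :- t) := s) refl s t) (+-monoʳ-≤ t (≮⇒≥ ge))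
    0<t+ε : 0ℚ < t + ε
    0<t+ε = 0<+ 0≤t 0<ε
    ss≤q : s * s ≤ q
    ss≤q with sqrtApprox-lower m q
    ... | inj₂ le = le
    ... | inj₁ eq = contradiction (<-≤-trans 0<t+ε (subst (t + ε ≤_) eq t+ε≤s)) (<-irrefl refl)
    0≤t+δ : 0ℚ ≤ t + δ n
    0≤t+δ = 0≤+ 0≤t (<⇒≤ (0<δ n))
    q<q : q < q
    q<q = begin-strict
      q                            ≡⟨ solve 2 (λ q q′ → q := q′ :+ (q :- q′)) refl q q′ ⟩
      q′ + (q - q′)                ≤⟨ +-monoʳ-≤ q′ (p≤∣p∣ (q - q′)) ⟩
      q′ + ∣ q - q′ ∣              <⟨ +-mono-< (sqrtApprox-upper n q′) q-q′< ⟩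
      (t + δ n) * (t + δ n) + h * h
        ≤⟨ +-monoˡ-≤ (h * h) (*-mono-≤ 0≤t+δ (≤-trans 0≤t+δ (+-monoʳ-≤ t δ≤)) (+-monoʳ-≤ t δ≤) (+-monoʳ-≤ t δ≤)) ⟩
      (t + h) * (t + h) + h * h    ≡⟨ sym (+-identityʳ _) ⟩
      (t + h) * (t + h) + h * h + 0ℚ
        ≤⟨ +-monoʳ-≤ ((t + h) * (t + h) + h * h) (0≤+ (0≤* 0≤t (<⇒≤ 0<ε)) (0≤* (<⇒≤ 0<ε) (<⇒≤ 0<h))) ⟩
      (t + h) * (t + h) + h * h + (t * ε + ε * h)
        ≡⟨ solve 2 (λ t e → let h = e :* con ½ in
             (t :+ h) :* (t :+ h) :+ h :* h :+ (t :* e :+ e :* h) := (t :+ e) :* (t :+ e)) refl t ε ⟩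
      (t + ε) * (t + ε)            ≤⟨ *-mono-≤ (<⇒≤ 0<t+ε) (≤-trans (<⇒≤ 0<t+ε) t+ε≤s) t+ε≤s t+ε≤s ⟩
      s * s                        ≤⟨ ss≤q ⟩
      q                            ∎

  sqrt-cauchy : ∀ {x} → Cauchy x → Cauchy (λ n → sqrtApprox n (x n))
  sqrt-cauchy {x} cx ε 0<ε
    with cx ((ε * ½) * (ε * ½)) (0<* (0<½* 0<ε) (0<½* 0<ε)) | δ-small (0<½* 0<ε)
  ... | N , p | M , q = N ℕ.⊔ M , λ m n N≤m N≤n →
    let N≤m′ = ℕₚ.m⊔n≤o⇒m≤o N M N≤m
        N≤n′ = ℕₚ.m⊔n≤o⇒m≤o N M N≤n
        s = sqrtApprox m (x m)
        t = sqrtApprox n (x n)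
    in ∣-∣-<
      (sqrtApprox-close 0<ε m n (x m) (x n) (q n (ℕₚ.m⊔n≤o⇒n≤o N M N≤n)) (p m n N≤m′ N≤n′))
      (subst (_< ε) (solve 2 (λ s t → t :- s := :- (s :- t)) refl s t)
        (sqrtApprox-close 0<ε n m (x n) (x m) (q m (ℕₚ.m⊔n≤o⇒n≤o N M N≤m)) (p n m N≤n′ N≤m′)))

infixl 7 _*ℝ_
infixl 6 _+ℝ_ _-ℝ_
infix  8 -ℝ_ √_

_+ℝ_ _*ℝ_ : ℝ → ℝ → ℝ
x +ℝ y = mkℝ (λ n → seq x n + seq y n) (RealProofs.+-cauchy {seq x} {seq y} (cauchy x) (cauchy y))
x *ℝ y = mkℝ (λ n → seq x n * seq y n) (RealProofs.*-cauchy {seq x} {seq y} (cauchy x) (cauchy y))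

-ℝ_ : ℝ → ℝ
-ℝ x = mkℝ (λ n → - seq x n) (RealProofs.neg-cauchy {seq x} (cauchy x))

_-ℝ_ : ℝ → ℝ → ℝ
x -ℝ y = x +ℝ (-ℝ y)

invℝ : (x : ℝ) → x #ℝ 0ℝ → ℝ
invℝ x x#0 = mkℝ (λ n → recip (seq x n))
  (RealProofs.recip-cauchy {seq x} (cauchy x) (RealProofs.away-from-0 {x} x#0))

-- √x for x ≥ 0 (and 0 for x ≤ 0).
√_ : ℝ → ℝ
√ x = mkℝ (λ n → sqrtApprox n (seq x n)) (RealProofs.sqrt-cauchy {seq x} (cauchy x))

record ℂ : Set where
  constructor _+i_
  field
    re : ℝ
    im : ℝ

open ℂ public

infix  4 _≈ℂ_
infixl 7 _*ℂ_

_≈ℂ_ : Rel ℂ 0ℓ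
z ≈ℂ w = re z ≈ℝ re w × im z ≈ℝ im w

0ℂ 1ℂ : ℂ
0ℂ = 0ℝ +i 0ℝ
1ℂ = 1ℝ +i 0ℝ

_*ℂ_ : ℂ → ℂ → ℂ
z *ℂ w = (re z *ℝ re w -ℝ im z *ℝ im w) +i (re z *ℝ im w +ℝ im z *ℝ re w)

conj : ℂ → ℂ
conj z = re z +i (-ℝ im z)

normSq : ℂ → ℝ
normSq z = re z *ℝ re z +ℝ im z *ℝ im z

∣_∣ℂ : ℂ → ℝ
∣ z ∣ℂ = √ normSq z

_/ℂ_⟨_⟩ : ℂ → (r : ℝ) → r #ℝ 0ℝ → ℂ
z /ℂ r ⟨ r#0 ⟩ = (re z *ℝ invℝ r r#0) +i (im z *ℝ invℝ r r#0)

-- z ≠ 0 read constructively, as z being apart from 0.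
NonZeroℂ : ℂ → Set
NonZeroℂ z = re z #ℝ 0ℝ ⊎ im z #ℝ 0ℝ

_∈ℝ⁺ : ℂ → Set
z ∈ℝ⁺ = im z ≈ℝ 0ℝ × 0ℝ <ℝ re z

_∈ℝ⁻ : ℂ → Set
z ∈ℝ⁻ = im z ≈ℝ 0ℝ × re z <ℝ 0ℝ

module ComplexProofs where

  open Rat
  open RealProofs using (away-from-0; sqrtApprox-upper; sqrtApprox-nonNeg)
  open +-*-Solver

  0<ℝ-intro : ∀ {x} d → 0ℚ < d → ∀ N → (∀ n → N ℕ.≤ n → d ≤ seq x n) → 0ℝ <ℝ x
  0<ℝ-intro {x} d 0<d N h =
    d , 0<d , N , λ n N≤n → subst (_≤ seq x n) (sym (+-identityˡ d)) (h n N≤n)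

  0<ℝ-elim : ∀ {x} → 0ℝ <ℝ x → ∃ λ d → 0ℚ < d × ∃ λ N → ∀ n → N ℕ.≤ n → d ≤ seq x n
  0<ℝ-elim {x} (d , 0<d , N , h) =
    d , 0<d , N , λ n N≤n → subst (_≤ seq x n) (+-identityˡ d) (h n N≤n)

  square-lower : ∀ {d} p q → 0ℚ < d → d ≤ ∣ p ∣ → d * d ≤ p * p + q * q
  square-lower {d} p q 0<d d≤∣p∣ = begin
    d * d              ≤⟨ *-mono-≤ (<⇒≤ 0<d) (0≤∣p∣ p) d≤∣p∣ d≤∣p∣ ⟩
    ∣ p ∣ * ∣ p ∣      ≡⟨ sym (p*p≡∣p∣*∣p∣ p) ⟩
    p * p              ≡⟨ sym (+-identityʳ (p * p)) ⟩
    p * p + 0ℚ         ≤⟨ +-monoʳ-≤ (p * p) (0≤p*p q) ⟩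
    p * p + q * q      ∎
    where open ≤-Reasoning

  normSq-pos : ∀ {z} → NonZeroℂ z → 0ℝ <ℝ normSq z
  normSq-pos {z} (inj₁ re#0) = finish (away-from-0 {re z} re#0)
    where
    finish : (∃ λ d → 0ℚ < d × ∃ λ N → ∀ n → N ℕ.≤ n → d ≤ ∣ seq (re z) n ∣) → 0ℝ <ℝ normSq z
    finish (d , 0<d , N , h) = 0<ℝ-intro {normSq z} (d * d) (0<* 0<d 0<d) N
      λ n N≤n → square-lower (seq (re z) n) (seq (im z) n) 0<d (h n N≤n)
  normSq-pos {z} (inj₂ im#0) = finish (away-from-0 {im z} im#0)
    where
    finish : (∃ λ d → 0ℚ < d × ∃ λ N → ∀ n → N ℕ.≤ n → d ≤ ∣ seq (im z) n ∣) → 0ℝ <ℝ normSq z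
    finish (d , 0<d , N , h) = 0<ℝ-intro {normSq z} (d * d) (0<* 0<d 0<d) N
      λ n N≤n → subst (d * d ≤_) (+-comm (seq (im z) n * seq (im z) n) (seq (re z) n * seq (re z) n))
        (square-lower (seq (im z) n) (seq (re z) n) 0<d (h n N≤n))

  brahmagupta : ∀ a b c d →
    (a * a + b * b) * (c * c + d * d) ≡
    (a * c - b * d) * (a * c - b * d) + (a * d + b * c) * (a * d + b * c)
  brahmagupta = solve 4 (λ a b c d →
    (a :* a :+ b :* b) :* (c :* c :+ d :* d) :=
    (a :* c :- b :* d) :* (a :* c :- b :* d) :+ (a :* d :+ b :* c) :* (a :* d :+ b :* c)) refl

  normSq-*-pos : ∀ {z w} → 0ℝ <ℝ normSq z → 0ℝ <ℝ normSq w → 0ℝ <ℝ normSq (z *ℂ w)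
  normSq-*-pos {z} {w} 0<z 0<w = finish (0<ℝ-elim {normSq z} 0<z) (0<ℝ-elim {normSq w} 0<w)
    where
    finish : (∃ λ d → 0ℚ < d × ∃ λ N → ∀ n → N ℕ.≤ n → d ≤ seq (normSq z) n) →
          (∃ λ d → 0ℚ < d × ∃ λ N → ∀ n → N ℕ.≤ n → d ≤ seq (normSq w) n) →
          0ℝ <ℝ normSq (z *ℂ w)
    finish (d , 0<d , N , h) (e , 0<e , M , k) =
      0<ℝ-intro {normSq (z *ℂ w)} (d * e) (0<* 0<d 0<e) (N ℕ.⊔ M) λ n N≤n →
        let h′ = h n (ℕₚ.m⊔n≤o⇒m≤o N M N≤n)
        in subst (d * e ≤_)
          (brahmagupta (seq (re z) n) (seq (im z) n) (seq (re w) n) (seq (im w) n))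
          (*-mono-≤ (<⇒≤ 0<e) (≤-trans (<⇒≤ 0<d) h′) h′ (k n (ℕₚ.m⊔n≤o⇒n≤o N M N≤n)))

  normSq-conj-pos : ∀ {z} → 0ℝ <ℝ normSq z → 0ℝ <ℝ normSq (conj z)
  normSq-conj-pos {z} (d , 0<d , N , h) = d , 0<d , N , λ n N≤n →
    subst (0ℚ + d ≤_) (even (seq (re z) n) (seq (im z) n)) (h n N≤n)
    where
    even : ∀ a b → a * a + b * b ≡ a * a + (- b) * (- b)
    even = solve 2 (λ a b → a :* a :+ b :* b := a :* a :+ (:- b) :* (:- b)) refl

  normSq-1-pos : 0ℝ <ℝ normSq 1ℂ
  normSq-1-pos = normSq-pos {1ℂ} (inj₁ (inj₂ (1ℚ , positive⁻¹ 1ℚ , 0 , λ _ _ → ≤-reflexive (+-identityˡ 1ℚ))))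

  -- With η = min d 1 one has η² ≤ d, so the approximate roots are
  -- eventually at least η/2.
  sqrtApprox-pos : ∀ {d q} n → 0ℚ < d → d ≤ q → δ n ≤ (d ⊓ 1ℚ) * ½ → (d ⊓ 1ℚ) * ½ ≤ sqrtApprox n q
  sqrtApprox-pos {d} {q} n 0<d d≤q δ≤ = subst₂ _≤_ lhs rhs (+-monoˡ-≤ (- h) η≤s+h)
    where
    open ≤-Reasoning
    η = d ⊓ 1ℚ
    h = η * ½
    s = sqrtApprox n q
    0≤η : 0ℚ ≤ η
    0≤η = ⊓-glb (<⇒≤ 0<d) (nonNegative⁻¹ 1ℚ)
    0≤s+δ : 0ℚ ≤ s + δ n
    0≤s+δ = 0≤+ (sqrtApprox-nonNeg n q) (<⇒≤ (0<δ n))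
    η≤s+h : η ≤ s + h
    η≤s+h = ≤-trans (square-≤⇒≤ 0≤s+δ (begin
      η * η                   ≤⟨ *-monoˡ-≤-nonNeg η {{nonNegative 0≤η}} (p⊓q≤q d 1ℚ) ⟩
      η * 1ℚ                  ≡⟨ *-identityʳ η ⟩
      η                       ≤⟨ p⊓q≤p d 1ℚ ⟩
      d                       ≤⟨ d≤q ⟩
      q                       ≤⟨ <⇒≤ (sqrtApprox-upper n q) ⟩
      (s + δ n) * (s + δ n)   ∎)) (+-monoʳ-≤ s δ≤)
    lhs : η + (- h) ≡ h
    lhs = solve 1 (λ η → η :+ (:- (η :* con ½)) := η :* con ½) refl η
    rhs : s + h + (- h) ≡ s
    rhs = solve 2 (λ s h → s :+ h :+ (:- h) := s) refl s h

  √-pos : ∀ {x} → 0ℝ <ℝ x → 0ℝ <ℝ √ x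
  √-pos {x} 0<x = finish (0<ℝ-elim {x} 0<x)
    where
    finish : (∃ λ d → 0ℚ < d × ∃ λ N → ∀ n → N ℕ.≤ n → d ≤ seq x n) → 0ℝ <ℝ √ x
    finish (d , 0<d , N , h) = finish′ (δ-small 0<η/2)
      where
      0<η/2 : 0ℚ < (d ⊓ 1ℚ) * ½
      0<η/2 = 0<½* (0<⊓ 0<d (positive⁻¹ 1ℚ))
      finish′ : (∃ λ M → ∀ n → M ℕ.≤ n → δ n ≤ (d ⊓ 1ℚ) * ½) → 0ℝ <ℝ √ x
      finish′ (M , δ≤) = 0<ℝ-intro {√ x} ((d ⊓ 1ℚ) * ½) 0<η/2 (N ℕ.⊔ M) λ n N≤n →
        sqrtApprox-pos n 0<d (h n (ℕₚ.m⊔n≤o⇒m≤o N M N≤n)) (δ≤ n (ℕₚ.m⊔n≤o⇒n≤o N M N≤n))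

-- Asymmetry makes each edge of the underlying graph carry exactly one
-- direction, and rules out loops. The value w i j matters only if i ⟶ j.
record WeightedOrientedGraph (n : ℕ) : Set₁ where
  field
    _⟶_       : Rel (Fin n) 0ℓ
    _⟶?_      : Decidable _⟶_
    ⟶-asym    : Asymmetric _⟶_
    w         : Fin n → Fin n → ℂ
    w-nonZero : ∀ {i j} → i ⟶ j → NonZeroℂ (w i j)

module _ {n : ℕ} (G : WeightedOrientedGraph n) where

  open WeightedOrientedGraph G

  numEdges : ℕ
  numEdges = length (filter (λ (i , j) → i ⟶? j) (cartesianProduct (allFin n) (allFin n)))

  Adj : Rel (Fin n) 0ℓ
  Adj i j = i ⟶ j ⊎ j ⟶ i

  Walk : Rel (Fin n) 0ℓ
  Walk = Star Adj

  a : Fin n → Fin n → ℂ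
  a i j with i ⟶? j | j ⟶? i
  ... | yes _ | _     = w i j
  ... | no  _ | yes _ = conj (w j i)
  ... | no  _ | no  _ = 0ℂ

  wt : ∀ {u v} → Walk u v → ℂ
  wt Star.ε                     = 1ℂ
  wt (_◅_ {i = i} {j = j} _ γ)  = a i j *ℂ wt γ

  len : ∀ {u v} → Walk u v → ℕ
  len Star.ε  = 0
  len (_ ◅ γ) = suc (len γ)

  -- The vertices (i₁, …, iₖ₋₁) of the walk (i₁, …, iₖ).
  initVertices : ∀ {u v} → Walk u v → List (Fin n)
  initVertices Star.ε             = []
  initVertices (_◅_ {i = i} _ γ)  = i ∷ initVertices γ

  -- A closed walk once around a cycle, with a chosen starting vertex and direction.
  IsCycle : ∀ {v} → Walk v v → Set
  IsCycle C = 3 ℕ.≤ len C × Unique (initVertices C)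

  WeaklyConnected : Set
  WeaklyConnected = ∀ u v → Walk u v

  IsShortest : ∀ {u v} → Walk u v → Set
  IsShortest {u} {v} γ = (γ′ : Walk u v) → len γ ℕ.≤ len γ′

  a-normSq-pos : ∀ {i j} → Adj i j → 0ℝ <ℝ normSq (a i j)
  a-normSq-pos {i} {j} i~j with i ⟶? j | j ⟶? i
  ... | yes i⟶j | _       = ComplexProofs.normSq-pos {w i j} (w-nonZero i⟶j)
  ... | no  _   | yes j⟶i =
    ComplexProofs.normSq-conj-pos {w j i} (ComplexProofs.normSq-pos {w j i} (w-nonZero j⟶i))
  a-normSq-pos (inj₁ i⟶j) | no ¬i⟶j | no _    = contradiction i⟶j ¬i⟶j
  a-normSq-pos (inj₂ j⟶i) | no _    | no ¬j⟶i = contradiction j⟶i ¬j⟶i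

  wt-normSq-pos : ∀ {u v} (γ : Walk u v) → 0ℝ <ℝ normSq (wt γ)
  wt-normSq-pos Star.ε = ComplexProofs.normSq-1-pos
  wt-normSq-pos (_◅_ {i = i} {j = j} i~j γ) =
    ComplexProofs.normSq-*-pos {a i j} {wt γ} (a-normSq-pos i~j) (wt-normSq-pos γ)

  ∣wt∣#0 : ∀ {u v} (γ : Walk u v) → ∣ wt γ ∣ℂ #ℝ 0ℝ
  ∣wt∣#0 γ = inj₂ (ComplexProofs.√-pos {normSq (wt γ)} (wt-normSq-pos γ))

{-# OPTIONS --safe #-}

-- For shortest walks γ₁ : u → v and γ₂ : v → u, wt(γ₁) wt(γ₂) is a positive
-- real, by induction on the total length.  If some vertex x other than v on
-- γ₁ is also a vertex other than u on γ₂, both walks are cut at x and the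
-- product splits into the products for the pairs (u, x) and (x, v).
-- Otherwise γ₁ followed by γ₂ is trivial, a single edge traversed back and
-- forth, or a cycle, whose length is even because γ₁ and γ₂ are equally long.  Applied to
-- γ₁ and the reverse of γ₂, whose weight is the conjugate of wt(γ₂), this says
-- that wt(γ₁) and wt(γ₂) have the same argument.
module Submission where

open import Defs
open import Data.Fin.Base using (Fin)
open import Data.Fin.Properties using (_≟_)
open import Data.List.Base using (_∷_; _++_)
open import Data.List.Membership.DecPropositional using (_∈?_)
open import Data.List.Membership.Propositional using (_∈_; find; lose)
open import Data.List.Relation.Unary.All.Properties using (¬Any⇒All¬)
open import Data.List.Relation.Unary.AllPairs using ([]; _∷_)
open import Data.List.Relation.Unary.Any using (here; there; any?)
open import Data.List.Relation.Unary.Unique.Propositional using (Unique)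
open import Data.List.Relation.Unary.Unique.Propositional.Properties using (++⁺)
open import Data.Nat.Base using (ℕ; _≤_; _<_; _+_; _⊔_; suc; z≤n; s≤s)
open import Data.Nat.Divisibility using (_∣_; divides)
open import Data.Nat.Induction using (<-wellFounded)
import Data.Nat.Properties as ℕₚ
open import Data.Product.Base using (∃; ∃₂; _×_; _,_; proj₁; proj₂)
import Data.Rational.Base as ℚ
open ℚ using (ℚ; 0ℚ; 1ℚ; ½)
import Data.Rational.Properties as ℚₚ
open import Data.Rational.Solver using (module +-*-Solver)
open import Data.Sum.Base using (inj₁; inj₂; swap)
open import Induction.WellFounded using (Acc; acc)
open import Level using (0ℓ)
open import Relation.Binary.Bundles using (Setoid)
open import Relation.Binary.Construct.Closure.ReflexiveTransitive using (ε; _◅_; _◅◅_)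
open import Relation.Binary.PropositionalEquality using (_≡_; refl; sym; trans; cong; cong₂; subst; subst₂; module ≡-Reasoning)
import Relation.Binary.Reasoning.Setoid as SetoidReasoning
open import Relation.Nullary using (¬_; yes; no; contradiction)
open Rat using (δ)
open RealProofs using (Bounded; bounded)
open +-*-Solver using (solve; con; :-_; _:+_; _:*_; _:-_; _:=_)
open WeightedOrientedGraph using (_⟶_; w)

-- Null sequences of rationals

-- x ≈ℝ y unfolds to Null (λ n → seq x n ℚ.- seq y n).
Null : (ℕ → ℚ) → Set
Null x = ∀ η → 0ℚ ℚ.< η → ∃ λ N → ∀ n → N ≤ n → ℚ.∣ x n ∣ ℚ.< η

Eventually : (ℕ → Set) → Set
Eventually P = ∃ λ N → ∀ n → N ≤ n → P n

eventually₂ : ∀ {P Q R : ℕ → Set} → (∀ n → P n → Q n → R n) →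
  Eventually P → Eventually Q → Eventually R
eventually₂ f (N , p) (M , q) = N ⊔ M , λ n N≤n →
  f n (p n (ℕₚ.m⊔n≤o⇒m≤o N M N≤n)) (q n (ℕₚ.m⊔n≤o⇒n≤o N M N≤n))

null-cong : ∀ {x y : ℕ → ℚ} → Eventually (λ n → x n ≡ y n) → Null x → Null y
null-cong x≡y x→0 η 0<η =
  eventually₂ (λ n eq → subst (λ p → ℚ.∣ p ∣ ℚ.< η) eq) x≡y (x→0 η 0<η)

null-cong′ : ∀ {x y : ℕ → ℚ} → (∀ n → x n ≡ y n) → Null x → Null y
null-cong′ x≡y = null-cong (0 , λ n _ → x≡y n)

null-squeeze : ∀ {x y : ℕ → ℚ} → (∀ n → ℚ.∣ y n ∣ ℚ.≤ x n) → Null x → Null y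
null-squeeze {x} y≤x x→0 η 0<η with x→0 η 0<η
... | N , h = N , λ n N≤n →
  ℚₚ.≤-<-trans (ℚₚ.≤-trans (y≤x n) (Rat.p≤∣p∣ (x n))) (h n N≤n)

null-+ : ∀ {x y : ℕ → ℚ} → Null x → Null y → Null (λ n → x n ℚ.+ y n)
null-+ {x} {y} x→0 y→0 η 0<η = eventually₂
  (λ n x<η/2 y<η/2 → ℚₚ.≤-<-trans (ℚₚ.∣p+q∣≤∣p∣+∣q∣ (x n) (y n))
    (subst (ℚ.∣ x n ∣ ℚ.+ ℚ.∣ y n ∣ ℚ.<_) (Rat.½-sum η) (ℚₚ.+-mono-< x<η/2 y<η/2)))
  (x→0 (η ℚ.* ½) (Rat.0<½* 0<η)) (y→0 (η ℚ.* ½) (Rat.0<½* 0<η))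

null-neg : ∀ {x : ℕ → ℚ} → Null x → Null (λ n → ℚ.- x n)
null-neg {x} x→0 η 0<η with x→0 η 0<η
... | N , h = N , λ n N≤n → subst (ℚ._< η) (sym (ℚₚ.∣-p∣≡∣p∣ (x n))) (h n N≤n)

bounded-*-null : ∀ {x y : ℕ → ℚ} → Bounded x → Null y → Null (λ n → x n ℚ.* y n)
bounded-*-null {x} {y} (B , 0<B , x≤B) y→0 η 0<η = eventually₂
  (λ n x≤B y<η/B → begin-strict
    ℚ.∣ x n ℚ.* y n ∣          ≡⟨ ℚₚ.∣p*q∣≡∣p∣*∣q∣ (x n) (y n) ⟩
    ℚ.∣ x n ∣ ℚ.* ℚ.∣ y n ∣    ≤⟨ ℚₚ.*-monoʳ-≤-nonNeg ℚ.∣ y n ∣ {{ℚₚ.∣-∣-nonNeg (y n)}} x≤B ⟩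
    B ℚ.* ℚ.∣ y n ∣            <⟨ ℚₚ.*-monoʳ-<-pos B {{ℚ.positive 0<B}} y<η/B ⟩
    B ℚ.* (B⁻¹ ℚ.* η)          ≡⟨ sym (ℚₚ.*-assoc B B⁻¹ η) ⟩
    B ℚ.* B⁻¹ ℚ.* η            ≡⟨ cong (ℚ._* η) (ℚₚ.*-inverseʳ B {{ℚ.>-nonZero 0<B}}) ⟩
    1ℚ ℚ.* η                   ≡⟨ ℚₚ.*-identityˡ η ⟩
    η                          ∎)
  -- The tolerance `η / B` for `y` offsets the factor `B` that bounds `x`.
  x≤B (y→0 (B⁻¹ ℚ.* η) (Rat.0<* (ℚₚ.positive⁻¹ B⁻¹ {{ℚₚ.1/pos⇒pos B {{ℚ.positive 0<B}}}}) 0<η))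
  where
  open ℚₚ.≤-Reasoning
  B⁻¹ : ℚ
  B⁻¹ = (ℚ.1/ B) {{ℚ.>-nonZero 0<B}}

-- Cauchy sequences are bounded. Only the first factor is a real: the second is typically a
-- difference of terms taken straight from a proof of `_≈ℝ_`.
null-* : ∀ x {y : ℕ → ℚ} → Null y → Null (λ n → seq x n ℚ.* y n)
null-* x = bounded-*-null (bounded {seq x} (cauchy x))

null-δ : Null δ
-- `δ-small` bounds only weakly, so it is aimed at `η / 2` to reach a strict bound by `η`.
null-δ η 0<η with Rat.δ-small (Rat.0<½* 0<η)
... | N , h = N , λ n N≤n → subst (ℚ._< η) (sym (ℚₚ.0≤p⇒∣p∣≡p (ℚₚ.<⇒≤ (Rat.0<δ n))))
  (ℚₚ.≤-<-trans (h n N≤n) (Rat.½*< 0<η))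

bounded-δ : Bounded δ
bounded-δ = 1ℚ , ℚₚ.positive⁻¹ 1ℚ , 0 , λ n _ →
  subst (ℚ._≤ 1ℚ) (sym (ℚₚ.0≤p⇒∣p∣≡p (ℚₚ.<⇒≤ (Rat.0<δ n)))) (Rat.δ-anti z≤n)

-- Positive reals, inverses and square roots

-- Once `x` is at least `d` and `y` lies within `d / 2` of it, `y` is at least `d / 2`.
0<ℝ-resp-≈ : ∀ x y → 0ℝ <ℝ x → x ≈ℝ y → 0ℝ <ℝ y
0<ℝ-resp-≈ x y 0<x x≈y =
  let d , 0<d , d≤x = ComplexProofs.0<ℝ-elim {x} 0<x
      N , h = eventually₂ (λ n → step d (seq x n) (seq y n)) d≤x (x≈y (d ℚ.* ½) (Rat.0<½* 0<d))
  in ComplexProofs.0<ℝ-intro {y} (d ℚ.* ½) (Rat.0<½* 0<d) N h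
  where
  open ℚₚ.≤-Reasoning
  step : ∀ d p q → d ℚ.≤ p → ℚ.∣ p ℚ.- q ∣ ℚ.< d ℚ.* ½ → d ℚ.* ½ ℚ.≤ q
  step d p q d≤p ∣p-q∣< = begin
    d ℚ.* ½          ≡⟨ solve 1 (λ d → d :* con ½ := d :- d :* con ½) refl d ⟩
    d ℚ.- d ℚ.* ½    ≤⟨ ℚₚ.+-monoˡ-≤ (ℚ.- (d ℚ.* ½)) d≤p ⟩
    p ℚ.- d ℚ.* ½    ≤⟨ ℚₚ.+-monoʳ-≤ p (ℚₚ.neg-antimono-≤ {p ℚ.- q} {d ℚ.* ½}
                          (ℚₚ.≤-trans (Rat.p≤∣p∣ (p ℚ.- q)) (ℚₚ.<⇒≤ ∣p-q∣<))) ⟩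
    p ℚ.- (p ℚ.- q)  ≡⟨ solve 2 (λ p q → p :- (p :- q) := q) refl p q ⟩
    q                ∎

0<ℝ-* : ∀ x y → 0ℝ <ℝ x → 0ℝ <ℝ y → 0ℝ <ℝ x *ℝ y
0<ℝ-* x y 0<x 0<y =
  let d , 0<d , d≤x = ComplexProofs.0<ℝ-elim {x} 0<x
      e , 0<e , e≤y = ComplexProofs.0<ℝ-elim {y} 0<y
      N , h = eventually₂ {R = λ n → d ℚ.* e ℚ.≤ seq x n ℚ.* seq y n}
        (λ n d≤ e≤ → Rat.*-mono-≤ (ℚₚ.<⇒≤ 0<e) (ℚₚ.≤-trans (ℚₚ.<⇒≤ 0<d) d≤) d≤ e≤) d≤x e≤y
  in ComplexProofs.0<ℝ-intro {x *ℝ y} (d ℚ.* e) (Rat.0<* 0<d 0<e) N h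

-- Nonnegativity of `y` is asked termwise, which products of approximate square roots satisfy
-- outright.
0<ℝ-+-nonNeg : ∀ x y → 0ℝ <ℝ x → (∀ n → 0ℚ ℚ.≤ seq y n) → 0ℝ <ℝ x +ℝ y
0<ℝ-+-nonNeg x y 0<x 0≤y =
  let d , 0<d , N , d≤x = ComplexProofs.0<ℝ-elim {x} 0<x
  in ComplexProofs.0<ℝ-intro {x +ℝ y} d 0<d N λ n N≤n →
    subst (ℚ._≤ seq x n ℚ.+ seq y n) (ℚₚ.+-identityʳ d)
      (ℚₚ.+-mono-≤ {d} {seq x n} {0ℚ} {seq y n} (d≤x n N≤n) (0≤y n))

-- Early terms of `x` may vanish, where `recip` takes its junk value; the identity starts at the
-- index from which `x` is bounded away from 0.
invℝ-inverse : ∀ x (x#0 : x #ℝ 0ℝ) → Eventually (λ n → seq (invℝ x x#0) n ℚ.* seq x n ≡ 1ℚ)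
invℝ-inverse x x#0 =
  let d , 0<d , N , d≤∣x∣ = RealProofs.away-from-0 {x} x#0
  in N , λ n N≤n → RealProofs.recip-inverse (seq x n) λ x≡0 →
    ℚₚ.<-irrefl refl (ℚₚ.<-≤-trans 0<d (subst (λ p → d ℚ.≤ ℚ.∣ p ∣) x≡0 (d≤∣x∣ n N≤n)))

-- Rounding down to a multiple of `δ n` gives `s² ≤ q < (s + δ n)²`, and the bound is the gap
-- between the two squares.
sqrtApprox-error : ∀ n q → 0ℚ ℚ.≤ q → let s = sqrtApprox n q in
  ℚ.∣ s ℚ.* s ℚ.- q ∣ ℚ.≤ s ℚ.* δ n ℚ.+ s ℚ.* δ n ℚ.+ δ n ℚ.* δ n
sqrtApprox-error n q 0≤q = bound (sqrtApprox n q) (δ n)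
  (RealProofs.sqrtApprox-nonNeg n q) (Rat.0<δ n) lower (RealProofs.sqrtApprox-upper n q)
  where
  lower : sqrtApprox n q ℚ.* sqrtApprox n q ℚ.≤ q
  lower with RealProofs.sqrtApprox-lower n q
  -- The search may never leave its start value 0; then `0≤q` supplies the bound.
  ... | inj₁ s≡0 = subst (λ s → s ℚ.* s ℚ.≤ q) (sym s≡0) 0≤q
  ... | inj₂ le  = le
  bound : ∀ s d → 0ℚ ℚ.≤ s → 0ℚ ℚ.< d → s ℚ.* s ℚ.≤ q → q ℚ.< (s ℚ.+ d) ℚ.* (s ℚ.+ d) →
    ℚ.∣ s ℚ.* s ℚ.- q ∣ ℚ.≤ s ℚ.* d ℚ.+ s ℚ.* d ℚ.+ d ℚ.* d
  bound s d 0≤s 0<d ss≤q q<[s+d]² = subst (ℚ._≤ _)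
    (trans (sym (ℚₚ.0≤p⇒∣p∣≡p 0≤q-ss)) (Rat.∣p-q∣≡∣q-p∣ q (s ℚ.* s)))
    (subst (q ℚ.- s ℚ.* s ℚ.≤_)
      (solve 2 (λ s d → (s :+ d) :* (s :+ d) :- s :* s := s :* d :+ s :* d :+ d :* d) refl s d)
      (ℚₚ.+-monoˡ-≤ (ℚ.- (s ℚ.* s)) (ℚₚ.<⇒≤ q<[s+d]²)))
    where
    0≤q-ss : 0ℚ ℚ.≤ q ℚ.- s ℚ.* s
    0≤q-ss = subst (ℚ._≤ q ℚ.- s ℚ.* s) (ℚₚ.+-inverseʳ (s ℚ.* s)) (ℚₚ.+-monoˡ-≤ (ℚ.- (s ℚ.* s)) ss≤q)

-- In the error bound `2sδ + δ²` the factor `s` is bounded, being a term of the Cauchy sequence of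
-- `√ x`, and `δ` is null.
√-square : ∀ x → (∀ n → 0ℚ ℚ.≤ seq x n) → √ x *ℝ √ x ≈ℝ x
√-square x 0≤x = null-squeeze (λ n → sqrtApprox-error n (seq x n) (0≤x n))
  (null-+ (null-+ sδ→0 sδ→0) (bounded-*-null {δ} {δ} bounded-δ null-δ))
  where
  sδ→0 : Null (λ n → seq (√ x) n ℚ.* δ n)
  sδ→0 = null-* (√ x) null-δ

-- Termwise identities between complex numbers

-- Products, conjugates and norms are computed termwise on the representing
-- sequences, so ring identities hold as equalities of sequences.
infix 4 _≐_

_≐_ : ℂ → ℂ → Set
z ≐ w = (∀ n → seq (re z) n ≡ seq (re w) n) × (∀ n → seq (im z) n ≡ seq (im w) n)

≐-setoid : Setoid 0ℓ 0ℓ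
≐-setoid = record
  { Carrier       = ℂ
  ; _≈_           = _≐_
  ; isEquivalence = record
    { refl  = (λ _ → refl) , (λ _ → refl)
    ; sym   = λ p → (λ n → sym (proj₁ p n)) , (λ n → sym (proj₂ p n))
    ; trans = λ p q → (λ n → trans (proj₁ p n) (proj₁ q n)) , (λ n → trans (proj₂ p n) (proj₂ q n))
    }
  }

open Setoid ≐-setoid using () renaming (refl to ≐-refl; sym to ≐-sym)

module ≐-Reasoning = SetoidReasoning ≐-setoid

*ℂ-cong : ∀ z z′ w w′ → z ≐ z′ → w ≐ w′ → z *ℂ w ≐ z′ *ℂ w′
*ℂ-cong _ _ _ _ p q =
  (λ n → cong₂ ℚ._-_ (cong₂ ℚ._*_ (proj₁ p n) (proj₁ q n)) (cong₂ ℚ._*_ (proj₂ p n) (proj₂ q n))) ,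
  (λ n → cong₂ ℚ._+_ (cong₂ ℚ._*_ (proj₁ p n) (proj₂ q n)) (cong₂ ℚ._*_ (proj₂ p n) (proj₁ q n)))

*ℂ-congˡ : ∀ z w w′ → w ≐ w′ → z *ℂ w ≐ z *ℂ w′
*ℂ-congˡ z w w′ = *ℂ-cong z z w w′ (≐-refl {z})

*ℂ-identityˡ : ∀ z → 1ℂ *ℂ z ≐ z
*ℂ-identityˡ z =
  (λ n → solve 2 (λ a b → con 1ℚ :* a :- con 0ℚ :* b := a) refl (seq (re z) n) (seq (im z) n)) ,
  (λ n → solve 2 (λ a b → con 1ℚ :* b :+ con 0ℚ :* a := b) refl (seq (re z) n) (seq (im z) n))

*ℂ-comm : ∀ z w → z *ℂ w ≐ w *ℂ z
*ℂ-comm z w =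
  (λ n → re-id (seq (re z) n) (seq (im z) n) (seq (re w) n) (seq (im w) n)) ,
  (λ n → im-id (seq (re z) n) (seq (im z) n) (seq (re w) n) (seq (im w) n))
  where
  re-id : ∀ a b c d → a ℚ.* c ℚ.- b ℚ.* d ≡ c ℚ.* a ℚ.- d ℚ.* b
  re-id = solve 4 (λ a b c d → a :* c :- b :* d := c :* a :- d :* b) refl
  im-id : ∀ a b c d → a ℚ.* d ℚ.+ b ℚ.* c ≡ c ℚ.* b ℚ.+ d ℚ.* a
  im-id = solve 4 (λ a b c d → a :* d :+ b :* c := c :* b :+ d :* a) refl

*ℂ-assoc : ∀ z w y → (z *ℂ w) *ℂ y ≐ z *ℂ (w *ℂ y)
*ℂ-assoc z w y =
  (λ n → solve 6 (λ a b c d e f →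
     (a :* c :- b :* d) :* e :- (a :* d :+ b :* c) :* f :=
     a :* (c :* e :- d :* f) :- b :* (c :* f :+ d :* e)) refl
     (seq (re z) n) (seq (im z) n) (seq (re w) n) (seq (im w) n) (seq (re y) n) (seq (im y) n)) ,
  (λ n → solve 6 (λ a b c d e f →
     (a :* c :- b :* d) :* f :+ (a :* d :+ b :* c) :* e :=
     a :* (c :* f :+ d :* e) :+ b :* (c :* e :- d :* f)) refl
     (seq (re z) n) (seq (im z) n) (seq (re w) n) (seq (im w) n) (seq (re y) n) (seq (im y) n))

-- Pairs the outer factors and the inner ones, as needed when two opposite walks are cut at a common
-- vertex: the first piece of one belongs with the last piece of the other.
*ℂ-nested : ∀ x y z w → (x *ℂ y) *ℂ (z *ℂ w) ≐ (x *ℂ w) *ℂ (y *ℂ z)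
*ℂ-nested x y z w = begin
  (x *ℂ y) *ℂ (z *ℂ w)  ≈⟨ *ℂ-assoc x y (z *ℂ w) ⟩
  x *ℂ (y *ℂ (z *ℂ w))  ≈⟨ *ℂ-congˡ x ((y *ℂ z) *ℂ w) (y *ℂ (z *ℂ w)) (*ℂ-assoc y z w) ⟨
  x *ℂ ((y *ℂ z) *ℂ w)  ≈⟨ *ℂ-congˡ x ((y *ℂ z) *ℂ w) (w *ℂ (y *ℂ z)) (*ℂ-comm (y *ℂ z) w) ⟩
  x *ℂ (w *ℂ (y *ℂ z))  ≈⟨ *ℂ-assoc x w (y *ℂ z) ⟨
  (x *ℂ w) *ℂ (y *ℂ z)  ∎
  where open ≐-Reasoning

conj-* : ∀ z w → conj z *ℂ conj w ≐ conj (z *ℂ w)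
conj-* z w =
  (λ n → solve 4 (λ a b c d → a :* c :- (:- b) :* (:- d) := a :* c :- b :* d) refl
     (seq (re z) n) (seq (im z) n) (seq (re w) n) (seq (im w) n)) ,
  (λ n → solve 4 (λ a b c d → a :* (:- d) :+ (:- b) :* c := :- (a :* d :+ b :* c)) refl
     (seq (re z) n) (seq (im z) n) (seq (re w) n) (seq (im w) n))

*ℂ-conj : ∀ z → z *ℂ conj z ≐ normSq z +i 0ℝ
*ℂ-conj z =
  (λ n → solve 2 (λ a b → a :* a :- b :* (:- b) := a :* a :+ b :* b) refl (seq (re z) n) (seq (im z) n)) ,
  (λ n → solve 2 (λ a b → a :* (:- b) :+ b :* a := con 0ℚ) refl (seq (re z) n) (seq (im z) n))

-- Complex numbers that are positive reals

≐-real : ∀ z r → 0ℝ <ℝ r → z ≐ r +i 0ℝ → z ∈ℝ⁺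
≐-real _ r (d , 0<d , N , h) z≐r =
  (λ η 0<η → 0 , λ n _ → subst (λ p → ℚ.∣ p ℚ.- 0ℚ ∣ ℚ.< η) (sym (proj₂ z≐r n)) 0<η) ,
  d , 0<d , N , λ n N≤n → subst (0ℚ ℚ.+ d ℚ.≤_) (sym (proj₁ z≐r n)) (h n N≤n)

∈ℝ⁺-resp-≐ : ∀ z w → z ≐ w → z ∈ℝ⁺ → w ∈ℝ⁺
∈ℝ⁺-resp-≐ _ _ z≐w (im≈0 , d , 0<d , N , h) =
  null-cong′ (λ n → cong (ℚ._- 0ℚ) (proj₂ z≐w n)) im≈0 ,
  d , 0<d , N , λ n N≤n → subst (0ℚ ℚ.+ d ℚ.≤_) (proj₁ z≐w n) (h n N≤n)

≈0⇒null : ∀ x → x ≈ℝ 0ℝ → Null (seq x)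
≈0⇒null x = null-cong′ (λ n → ℚₚ.+-identityʳ (seq x n))

∈ℝ⁺-* : ∀ z w → z ∈ℝ⁺ → w ∈ℝ⁺ → (z *ℂ w) ∈ℝ⁺
∈ℝ⁺-* z w (im-z≈0 , 0<re-z) (im-w≈0 , 0<re-w) =
  null-cong′
    (λ n → solve 4 (λ a b c d → a :* d :+ c :* b := a :* d :+ b :* c :- con 0ℚ) refl
      (seq (re z) n) (seq (im z) n) (seq (re w) n) (seq (im w) n))
    (null-+ (null-* (re z) im-w→0) (null-* (re w) im-z→0)) ,
  -- The imaginary parts are null rather than termwise zero, so the real part of the product is only
  -- `≈ℝ` to `re z *ℝ re w`, differing from it by a null product.
  0<ℝ-resp-≈ (re z *ℝ re w) (re (z *ℂ w)) (0<ℝ-* (re z) (re w) 0<re-z 0<re-w)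
    (null-cong′
      (λ n → solve 4 (λ a b c d → b :* d := a :* c :- (a :* c :- b :* d)) refl
        (seq (re z) n) (seq (im z) n) (seq (re w) n) (seq (im w) n))
      (null-* (im z) im-w→0))
  where
  im-z→0 = ≈0⇒null (im z) im-z≈0
  im-w→0 = ≈0⇒null (im w) im-w≈0

-- Equality of arguments

module _ (z w : ℂ) (z#0 : ∣ z ∣ℂ #ℝ 0ℝ) (w#0 : ∣ w ∣ℂ #ℝ 0ℝ) (zw̄>0 : (z *ℂ conj w) ∈ℝ⁺) where

  private
    R S P Q : ℝ
    R = ∣ z ∣ℂ
    S = ∣ w ∣ℂ
    P = re (z *ℂ conj w)
    Q = im (z *ℂ conj w)

    normSq-nonNeg : ∀ y n → 0ℚ ℚ.≤ seq (normSq y) n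
    normSq-nonNeg y n = Rat.0≤+ (Rat.0≤p*p (seq (re y) n)) (Rat.0≤p*p (seq (im y) n))

    R²≈ : R *ℝ R ≈ℝ normSq z
    R²≈ = √-square (normSq z) (normSq-nonNeg z)

    S²≈ : S *ℝ S ≈ℝ normSq w
    S²≈ = √-square (normSq w) (normSq-nonNeg w)

    Q→0 : Null (seq Q)
    Q→0 = ≈0⇒null Q (proj₁ zw̄>0)

    -- From `P² = R²S²` alone `P` could also be `−RS`. Positivity of `P` excludes this by making
    -- `P + RS` invertible.
    0<P+RS : 0ℝ <ℝ P +ℝ R *ℝ S
    0<P+RS = 0<ℝ-+-nonNeg P (R *ℝ S) (proj₂ zw̄>0) λ n → Rat.0≤*
      (RealProofs.sqrtApprox-nonNeg n (seq (normSq z) n))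
      (RealProofs.sqrtApprox-nonNeg n (seq (normSq w) n))

    -- P² + Q² = |z|² |w|², hence (P − RS)(P + RS) → 0.
    P²-R²S²-id : ∀ a b c d r s →
      let p = a ℚ.* c ℚ.- b ℚ.* (ℚ.- d)
          q = a ℚ.* (ℚ.- d) ℚ.+ b ℚ.* c
      in ℚ.- (q ℚ.* q ℚ.+ (a ℚ.* a ℚ.+ b ℚ.* b) ℚ.* (s ℚ.* s ℚ.- (c ℚ.* c ℚ.+ d ℚ.* d))
           ℚ.+ s ℚ.* s ℚ.* (r ℚ.* r ℚ.- (a ℚ.* a ℚ.+ b ℚ.* b)))
         ≡ (p ℚ.- r ℚ.* s) ℚ.* (p ℚ.+ r ℚ.* s)
    P²-R²S²-id = solve 6 (λ a b c d r s →
      let p = a :* c :- b :* (:- d)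
          q = a :* (:- d) :+ b :* c
      in :- (q :* q :+ (a :* a :+ b :* b) :* (s :* s :- (c :* c :+ d :* d))
           :+ s :* s :* (r :* r :- (a :* a :+ b :* b)))
         := (p :- r :* s) :* (p :+ r :* s)) refl

    P≈RS : P ≈ℝ R *ℝ S
    -- The null product `(P − RS)(P + RS)` is multiplied by the inverse of `P + RS`. The
    -- cancellation is valid only from some index on.
    P≈RS = null-cong (cancel (invℝ-inverse (P +ℝ R *ℝ S) P+RS#0))
      (null-* (invℝ (P +ℝ R *ℝ S) P+RS#0) P²-R²S²→0)
      where
      P+RS#0 : (P +ℝ R *ℝ S) #ℝ 0ℝ
      P+RS#0 = inj₂ 0<P+RS
      P²-R²S²→0 : Null (λ n → (seq P n ℚ.- seq R n ℚ.* seq S n) ℚ.* (seq P n ℚ.+ seq R n ℚ.* seq S n))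
      P²-R²S²→0 = null-cong′
        (λ n → P²-R²S²-id (seq (re z) n) (seq (im z) n) (seq (re w) n) (seq (im w) n) (seq R n) (seq S n))
        -- Each summand of the identity contains a null factor: `Q`, `S² − |w|²` or `R² − |z|²`.
        (null-neg (null-+ (null-+ (null-* Q Q→0) (null-* (normSq z) S²≈)) (null-* (S *ℝ S) R²≈)))
      cancel : Eventually (λ n → seq (invℝ (P +ℝ R *ℝ S) P+RS#0) n ℚ.* seq (P +ℝ R *ℝ S) n ≡ 1ℚ) → _
      cancel (N , h) = N , λ n N≤n → begin
        _ ≡⟨ solve 3 (λ i x y → i :* (x :* y) := x :* (i :* y)) refl
               (seq (invℝ (P +ℝ R *ℝ S) P+RS#0) n) (seq P n ℚ.- seq R n ℚ.* seq S n) (seq (P +ℝ R *ℝ S) n) ⟩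
        _ ≡⟨ cong ((seq P n ℚ.- seq R n ℚ.* seq S n) ℚ.*_) (h n N≤n) ⟩
        _ ≡⟨ ℚₚ.*-identityʳ _ ⟩
        _ ∎
        where open ≡-Reasoning

    divide : ∀ x y → x *ℝ (S *ℝ S) ≈ℝ y *ℝ (R *ℝ S) → x *ℝ invℝ R z#0 ≈ℝ y *ℝ invℝ S w#0
    divide x y eq = null-cong
      (eventually₂ (λ n → id-eq (seq x n) (seq y n) (seq R n) (seq S n)
                            (seq (invℝ R z#0) n) (seq (invℝ S w#0) n))
        (invℝ-inverse R z#0) (invℝ-inverse S w#0))
      -- The difference of the two sides is multiplied by `1 / (R S²)`.
      (null-* (invℝ R z#0 *ℝ (invℝ S w#0 *ℝ invℝ S w#0)) eq)
      where
      id-eq : ∀ x y r s r⁻¹ s⁻¹ → r⁻¹ ℚ.* r ≡ 1ℚ → s⁻¹ ℚ.* s ≡ 1ℚ →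
        r⁻¹ ℚ.* (s⁻¹ ℚ.* s⁻¹) ℚ.* (x ℚ.* (s ℚ.* s) ℚ.- y ℚ.* (r ℚ.* s)) ≡ x ℚ.* r⁻¹ ℚ.- y ℚ.* s⁻¹
      id-eq x y r s r⁻¹ s⁻¹ r⁻¹r≡1 s⁻¹s≡1 = begin
        r⁻¹ ℚ.* (s⁻¹ ℚ.* s⁻¹) ℚ.* (x ℚ.* (s ℚ.* s) ℚ.- y ℚ.* (r ℚ.* s))
          ≡⟨ solve 6 (λ x y r s r⁻¹ s⁻¹ →
               r⁻¹ :* (s⁻¹ :* s⁻¹) :* (x :* (s :* s) :- y :* (r :* s)) :=
               x :* r⁻¹ :* ((s⁻¹ :* s) :* (s⁻¹ :* s)) :- y :* s⁻¹ :* ((r⁻¹ :* r) :* (s⁻¹ :* s)))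
               refl x y r s r⁻¹ s⁻¹ ⟩
        x ℚ.* r⁻¹ ℚ.* ((s⁻¹ ℚ.* s) ℚ.* (s⁻¹ ℚ.* s)) ℚ.- y ℚ.* s⁻¹ ℚ.* ((r⁻¹ ℚ.* r) ℚ.* (s⁻¹ ℚ.* s))
          ≡⟨ cong₂ (λ e f → x ℚ.* r⁻¹ ℚ.* (f ℚ.* f) ℚ.- y ℚ.* s⁻¹ ℚ.* (e ℚ.* f)) r⁻¹r≡1 s⁻¹s≡1 ⟩
        x ℚ.* r⁻¹ ℚ.* 1ℚ ℚ.- y ℚ.* s⁻¹ ℚ.* 1ℚ
          ≡⟨ cong₂ ℚ._-_ (ℚₚ.*-identityʳ (x ℚ.* r⁻¹)) (ℚₚ.*-identityʳ (y ℚ.* s⁻¹)) ⟩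
        x ℚ.* r⁻¹ ℚ.- y ℚ.* s⁻¹ ∎
        where open ≡-Reasoning

    -- z |w|² = (z w̄) w = (P + iQ) w
    re-id : ∀ a b c d r s →
      let p = a ℚ.* c ℚ.- b ℚ.* (ℚ.- d)
          q = a ℚ.* (ℚ.- d) ℚ.+ b ℚ.* c
      in a ℚ.* (s ℚ.* s ℚ.- (c ℚ.* c ℚ.+ d ℚ.* d)) ℚ.+ ℚ.- (d ℚ.* q) ℚ.+ c ℚ.* (p ℚ.- r ℚ.* s)
         ≡ a ℚ.* (s ℚ.* s) ℚ.- c ℚ.* (r ℚ.* s)
    re-id = solve 6 (λ a b c d r s →
      let p = a :* c :- b :* (:- d)
          q = a :* (:- d) :+ b :* c
      in a :* (s :* s :- (c :* c :+ d :* d)) :+ (:- (d :* q)) :+ c :* (p :- r :* s)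
         := a :* (s :* s) :- c :* (r :* s)) refl

    im-id : ∀ a b c d r s →
      let p = a ℚ.* c ℚ.- b ℚ.* (ℚ.- d)
          q = a ℚ.* (ℚ.- d) ℚ.+ b ℚ.* c
      in b ℚ.* (s ℚ.* s ℚ.- (c ℚ.* c ℚ.+ d ℚ.* d)) ℚ.+ c ℚ.* q ℚ.+ d ℚ.* (p ℚ.- r ℚ.* s)
         ≡ b ℚ.* (s ℚ.* s) ℚ.- d ℚ.* (r ℚ.* s)
    im-id = solve 6 (λ a b c d r s →
      let p = a :* c :- b :* (:- d)
          q = a :* (:- d) :+ b :* c
      in b :* (s :* s :- (c :* c :+ d :* d)) :+ c :* q :+ d :* (p :- r :* s)
         := b :* (s :* s) :- d :* (r :* s)) refl

  -- With `P = RS` and `Q = 0`, the product `z |w|²` becomes `R S w`. The real and imaginary parts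
  -- of this equation are divided by `R S²` separately.
  normalised-≈ : (z /ℂ ∣ z ∣ℂ ⟨ z#0 ⟩) ≈ℂ (w /ℂ ∣ w ∣ℂ ⟨ w#0 ⟩)
  normalised-≈ =
    divide (re z) (re w) (null-cong′
      (λ n → re-id (seq (re z) n) (seq (im z) n) (seq (re w) n) (seq (im w) n) (seq R n) (seq S n))
      (null-+ (null-+ (null-* (re z) S²≈) (null-neg (null-* (im w) Q→0))) (null-* (re w) P≈RS))) ,
    divide (im z) (im w) (null-cong′
      (λ n → im-id (seq (re z) n) (seq (im z) n) (seq (re w) n) (seq (im w) n) (seq R n) (seq S n))
      (null-+ (null-+ (null-* (im z) S²≈) (null-* (re w) Q→0)) (null-* (im w) P≈RS)))

-- Walks

module _ {n : ℕ} (G : WeightedOrientedGraph n) where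

  open WeightedOrientedGraph G using (_⟶?_; ⟶-asym)

  a-conj : ∀ i j → a G j i ≐ conj (a G i j)
  a-conj i j with i ⟶? j | j ⟶? i
  -- With both directions present the two entries would be the unrelated weights `w i j` and
  -- `w j i`.
  ... | yes i⟶j | yes j⟶i = contradiction j⟶i (⟶-asym i⟶j)
  ... | yes _   | no  _   = (λ _ → refl) , (λ _ → refl)
  ... | no  _   | yes _   = (λ _ → refl) ,
    (λ k → solve 1 (λ p → p := :- (:- p)) refl (seq (im (w G j i)) k))
  ... | no  _   | no  _   = (λ _ → refl) , (λ _ → refl)

  len-◅◅ : ∀ {u v x} (α : Walk G u x) (β : Walk G x v) → len G (α ◅◅ β) ≡ len G α + len G β
  len-◅◅ ε       β = refl
  len-◅◅ (_ ◅ α) β = cong suc (len-◅◅ α β)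

  initVertices-◅◅ : ∀ {u v x} (α : Walk G u x) (β : Walk G x v) →
    initVertices G (α ◅◅ β) ≡ initVertices G α ++ initVertices G β
  initVertices-◅◅ ε                   β = refl
  initVertices-◅◅ (_◅_ {i = i} _ α)   β = cong (i ∷_) (initVertices-◅◅ α β)

  wt-◅◅ : ∀ {u v x} (α : Walk G u x) (β : Walk G x v) → wt G (α ◅◅ β) ≐ wt G α *ℂ wt G β
  wt-◅◅ ε β = ≐-sym {1ℂ *ℂ wt G β} {wt G β} (*ℂ-identityˡ (wt G β))
  wt-◅◅ (_◅_ {i = i} {j = j} _ α) β = begin
    a G i j *ℂ wt G (α ◅◅ β)        ≈⟨ *ℂ-congˡ (a G i j) (wt G (α ◅◅ β)) (wt G α *ℂ wt G β) (wt-◅◅ α β) ⟩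
    a G i j *ℂ (wt G α *ℂ wt G β)   ≈⟨ *ℂ-assoc (a G i j) (wt G α) (wt G β) ⟨
    (a G i j *ℂ wt G α) *ℂ wt G β   ∎
    where open ≐-Reasoning

  reverse : ∀ {u v} → Walk G u v → Walk G v u
  reverse ε       = ε
  reverse (e ◅ γ) = reverse γ ◅◅ (swap e ◅ ε)

  len-reverse : ∀ {u v} (γ : Walk G u v) → len G (reverse γ) ≡ len G γ
  len-reverse ε       = refl
  len-reverse (e ◅ γ) = begin
    len G (reverse γ ◅◅ (swap e ◅ ε))  ≡⟨ len-◅◅ (reverse γ) (swap e ◅ ε) ⟩
    len G (reverse γ) + 1              ≡⟨ cong (_+ 1) (len-reverse γ) ⟩
    len G γ + 1                        ≡⟨ ℕₚ.+-comm (len G γ) 1 ⟩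
    suc (len G γ)                      ∎
    where open ≡-Reasoning

  -- Each edge factor is conjugated by `a-conj`, and commutativity undoes the reversed order of the
  -- factors.
  wt-reverse : ∀ {u v} (γ : Walk G u v) → wt G (reverse γ) ≐ conj (wt G γ)
  wt-reverse ε = (λ _ → refl) , (λ _ → refl)
  wt-reverse (_◅_ {i = i} {j = j} e γ) = begin
    wt G (reverse γ ◅◅ (swap e ◅ ε))         ≈⟨ wt-◅◅ (reverse γ) (swap e ◅ ε) ⟩
    wt G (reverse γ) *ℂ (a G j i *ℂ 1ℂ)      ≈⟨ *ℂ-comm (wt G (reverse γ)) (a G j i *ℂ 1ℂ) ⟩
    (a G j i *ℂ 1ℂ) *ℂ wt G (reverse γ)      ≈⟨ *ℂ-cong (a G j i *ℂ 1ℂ) (conj (a G i j))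
                                                  (wt G (reverse γ)) (conj (wt G γ)) edge (wt-reverse γ) ⟩
    conj (a G i j) *ℂ conj (wt G γ)          ≈⟨ conj-* (a G i j) (wt G γ) ⟩
    conj (a G i j *ℂ wt G γ)                 ∎
    where
    open ≐-Reasoning
    edge : a G j i *ℂ 1ℂ ≐ conj (a G i j)
    edge = begin
      a G j i *ℂ 1ℂ   ≈⟨ *ℂ-comm (a G j i) 1ℂ ⟩
      1ℂ *ℂ a G j i   ≈⟨ *ℂ-identityˡ (a G j i) ⟩
      a G j i         ≈⟨ a-conj i j ⟩
      conj (a G i j)  ∎

  -- Shortest walks and their pieces

  shortest-reverse : ∀ {u v} (γ : Walk G u v) → IsShortest G γ → IsShortest G (reverse γ)
  shortest-reverse γ sh γ′ =
    subst₂ _≤_ (sym (len-reverse γ)) (len-reverse γ′) (sh (reverse γ′))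

  -- Each walk competes with the reverse of the other.
  shortest-len-sym : ∀ {u v} (γ₁ : Walk G u v) (γ₂ : Walk G v u) →
    IsShortest G γ₁ → IsShortest G γ₂ → len G γ₁ ≡ len G γ₂
  shortest-len-sym γ₁ γ₂ sh₁ sh₂ = ℕₚ.≤-antisym
    (subst (len G γ₁ ≤_) (len-reverse γ₂) (sh₁ (reverse γ₂)))
    (subst (len G γ₂ ≤_) (len-reverse γ₁) (sh₂ (reverse γ₁)))

  -- A shorter replacement for a piece would shorten the whole walk.
  shortest-◅◅ˡ : ∀ {u v x} (α : Walk G u x) (β : Walk G x v) → IsShortest G (α ◅◅ β) → IsShortest G α
  shortest-◅◅ˡ α β sh α′ = ℕₚ.+-cancelʳ-≤ (len G β) (len G α) (len G α′)
    (subst₂ _≤_ (len-◅◅ α β) (len-◅◅ α′ β) (sh (α′ ◅◅ β)))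

  shortest-◅◅ʳ : ∀ {u v x} (α : Walk G u x) (β : Walk G x v) → IsShortest G (α ◅◅ β) → IsShortest G β
  shortest-◅◅ʳ α β sh β′ = ℕₚ.+-cancelˡ-≤ (len G α) (len G β) (len G β′)
    (subst₂ _≤_ (len-◅◅ α β) (len-◅◅ α β′) (sh (α ◅◅ β′)))

  -- `initVertices` omits the final position, so the part after the cut has at least one edge. This
  -- makes the later induction strictly decrease.
  split : ∀ {u v x} (γ : Walk G u v) → x ∈ initVertices G γ →
    ∃₂ λ (α : Walk G u x) (β : Walk G x v) → γ ≡ α ◅◅ β × 1 ≤ len G β
  split (e ◅ γ) (here refl) = ε , e ◅ γ , refl , s≤s z≤n
  split (e ◅ γ) (there x∈γ) with split γ x∈γ
  ... | α , β , eq , 1≤β = e ◅ α , β , cong (e ◅_) eq , 1≤β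

  shortest-unique : ∀ {u v} (γ : Walk G u v) → IsShortest G γ → Unique (initVertices G γ)
  shortest-unique ε       sh = []
  shortest-unique {u} (e ◅ γ) sh =
    ¬Any⇒All¬ _ u∉γ ∷ shortest-unique γ (shortest-◅◅ʳ (e ◅ ε) γ sh)
    where
    u∉γ : ¬ (u ∈ initVertices G γ)
    u∉γ u∈γ with split γ u∈γ
    -- If `u` recurs, `β` is itself a walk from `u` to `v` that avoids at least the edge `e`.
    ... | α , β , refl , _ = ℕₚ.<-irrefl refl (ℕₚ.≤-trans (sh β)
      (subst (len G β ≤_) (sym (len-◅◅ α β)) (ℕₚ.m≤n+m (len G β) (len G α))))

  -- Products of opposite shortest walks

  EvenCyclesPositive : Set
  EvenCyclesPositive = ∀ v (C : Walk G v v) → IsCycle G C → 2 ∣ len G C → wt G C ∈ℝ⁺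

  module _ (positive : EvenCyclesPositive) where

    private
      -- The vertex list of each walk leaves out the starting vertex of the other, so disjoint lists
      -- mean that the closed walk repeats no vertex. The bound `2 ≤ len G γ₁` rules out an edge
      -- traversed back and forth: the total length is then at least 4.
      disjoint-case : ∀ {u v} (γ₁ : Walk G u v) (γ₂ : Walk G v u) →
        IsShortest G γ₁ → IsShortest G γ₂ → 2 ≤ len G γ₁ →
        (∀ {x} → ¬ (x ∈ initVertices G γ₁ × x ∈ initVertices G γ₂)) →
        (wt G γ₁ *ℂ wt G γ₂) ∈ℝ⁺
      disjoint-case {u} γ₁ γ₂ sh₁ sh₂ 2≤ disjoint =
        ∈ℝ⁺-resp-≐ (wt G (γ₁ ◅◅ γ₂)) (wt G γ₁ *ℂ wt G γ₂) (wt-◅◅ γ₁ γ₂)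
          (positive u (γ₁ ◅◅ γ₂) (3≤len , unique) even)
        where
        k = len G γ₁
        len≡k+k : len G (γ₁ ◅◅ γ₂) ≡ k + k
        len≡k+k = trans (len-◅◅ γ₁ γ₂) (cong (k +_) (sym (shortest-len-sym γ₁ γ₂ sh₁ sh₂)))
        3≤len : 3 ≤ len G (γ₁ ◅◅ γ₂)
        3≤len = subst (3 ≤_) (sym len≡k+k) (ℕₚ.≤-trans (ℕₚ.n≤1+n 3) (ℕₚ.+-mono-≤ 2≤ 2≤))
        unique : Unique (initVertices G (γ₁ ◅◅ γ₂))
        unique = subst Unique (sym (initVertices-◅◅ γ₁ γ₂))
          (++⁺ (shortest-unique γ₁ sh₁) (shortest-unique γ₂ sh₂) disjoint)
        even : 2 ∣ len G (γ₁ ◅◅ γ₂)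
        even = divides k (trans len≡k+k (trans (cong (k +_) (sym (ℕₚ.+-identityʳ k))) (ℕₚ.*-comm 2 k)))

    -- The pieces returned by `split` are not structural subterms, so the recursion runs on
    -- accessibility of the total length.
    shortest-product : ∀ {u v} (γ₁ : Walk G u v) (γ₂ : Walk G v u) →
      IsShortest G γ₁ → IsShortest G γ₂ →
      Acc _<_ (len G γ₁ + len G γ₂) → (wt G γ₁ *ℂ wt G γ₂) ∈ℝ⁺
    shortest-product γ₁ γ₂ sh₁ sh₂ (acc rec)
      with any? (λ x → _∈?_ _≟_ x (initVertices G γ₂)) (initVertices G γ₁)
    ... | yes common with find common
    ... | x , x∈γ₁ , x∈γ₂ with split γ₁ x∈γ₁ | split γ₂ x∈γ₂
    ... | α₁ , β₁ , refl , 1≤β₁ | β₂ , α₂ , refl , 1≤α₂ =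
      ∈ℝ⁺-resp-≐ ((wt G α₁ *ℂ wt G α₂) *ℂ (wt G β₁ *ℂ wt G β₂)) (wt G (α₁ ◅◅ β₁) *ℂ wt G (β₂ ◅◅ α₂)) regroup
        (∈ℝ⁺-* (wt G α₁ *ℂ wt G α₂) (wt G β₁ *ℂ wt G β₂)
          (shortest-product α₁ α₂ (shortest-◅◅ˡ α₁ β₁ sh₁) (shortest-◅◅ʳ β₂ α₂ sh₂) (rec α<))
          (shortest-product β₁ β₂ (shortest-◅◅ʳ α₁ β₁ sh₁) (shortest-◅◅ˡ β₂ α₂ sh₂) (rec β<)))
      where
      open ≐-Reasoning
      regroup : (wt G α₁ *ℂ wt G α₂) *ℂ (wt G β₁ *ℂ wt G β₂) ≐ wt G (α₁ ◅◅ β₁) *ℂ wt G (β₂ ◅◅ α₂)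
      regroup = begin
        (wt G α₁ *ℂ wt G α₂) *ℂ (wt G β₁ *ℂ wt G β₂)
          ≈⟨ *ℂ-nested (wt G α₁) (wt G β₁) (wt G β₂) (wt G α₂) ⟨
        (wt G α₁ *ℂ wt G β₁) *ℂ (wt G β₂ *ℂ wt G α₂)
          ≈⟨ *ℂ-cong (wt G (α₁ ◅◅ β₁)) (wt G α₁ *ℂ wt G β₁) (wt G (β₂ ◅◅ α₂)) (wt G β₂ *ℂ wt G α₂)
               (wt-◅◅ α₁ β₁) (wt-◅◅ β₂ α₂) ⟨
        wt G (α₁ ◅◅ β₁) *ℂ wt G (β₂ ◅◅ α₂) ∎
      -- The first pair is smaller because it loses the nonempty `β₁`, the second because it loses
      -- the nonempty `α₂`.
      α< : len G α₁ + len G α₂ < len G (α₁ ◅◅ β₁) + len G (β₂ ◅◅ α₂)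
      α< rewrite len-◅◅ α₁ β₁ | len-◅◅ β₂ α₂ =
        ℕₚ.+-mono-<-≤ (ℕₚ.m<m+n (len G α₁) 1≤β₁) (ℕₚ.m≤n+m (len G α₂) (len G β₂))
      β< : len G β₁ + len G β₂ < len G (α₁ ◅◅ β₁) + len G (β₂ ◅◅ α₂)
      β< rewrite len-◅◅ α₁ β₁ | len-◅◅ β₂ α₂ =
        ℕₚ.+-mono-≤-< (ℕₚ.m≤n+m (len G β₁) (len G α₁)) (ℕₚ.m<m+n (len G β₂) 1≤α₂)
    shortest-product ε ε sh₁ sh₂ _ | no _ =
      -- The terms of `conj 1ℂ` compute to those of `1ℂ`, so `*ℂ-conj` applies.
      ≐-real (1ℂ *ℂ 1ℂ) (normSq 1ℂ) ComplexProofs.normSq-1-pos (*ℂ-conj 1ℂ)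
    -- If one walk is trivial, then `u` and `v` coincide and `ε` beats any nontrivial partner.
    shortest-product ε (e ◅ γ) sh₁ sh₂ _ | no _ = contradiction (sh₂ ε) λ ()
    shortest-product (e ◅ ε) ε sh₁ sh₂ _ | no _ = contradiction (sh₁ ε) λ ()
    -- The reversed edge `swap e` is shorter than a walk with two or more edges.
    shortest-product (e ◅ ε) (f ◅ g ◅ γ) sh₁ sh₂ _ | no _ =
      contradiction (sh₂ (swap e ◅ ε)) λ { (s≤s ()) }
    shortest-product (e ◅ ε) (f ◅ ε) sh₁ sh₂ _ | no _ = ≐-real (wt G (e ◅ ε) *ℂ wt G (f ◅ ε))
      (normSq (wt G (e ◅ ε))) (wt-normSq-pos G (e ◅ ε)) (begin
      wt G (e ◅ ε) *ℂ wt G (f ◅ ε)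
        -- `wt` reads only the endpoints of an edge, so `f` weighs the same as `swap e` even if the
        -- two adjacency proofs differ.
        ≈⟨ *ℂ-congˡ (wt G (e ◅ ε)) (wt G (f ◅ ε)) (conj (wt G (e ◅ ε))) (wt-reverse (e ◅ ε)) ⟩
      wt G (e ◅ ε) *ℂ conj (wt G (e ◅ ε))
        ≈⟨ *ℂ-conj (wt G (e ◅ ε)) ⟩
      normSq (wt G (e ◅ ε)) +i 0ℝ ∎)
      where open ≐-Reasoning
    shortest-product γ₁@(_ ◅ _ ◅ _) γ₂ sh₁ sh₂ _ | no disjoint =
      disjoint-case γ₁ γ₂ sh₁ sh₂ (s≤s (s≤s z≤n)) λ (x∈γ₁ , x∈γ₂) → disjoint (lose x∈γ₁ x∈γ₂)

lemma2p3 : (n m : ℕ) → 2 ≤ n → 1 ≤ m →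
    (G : WeightedOrientedGraph n) → numEdges G ≡ m → WeaklyConnected G →
    (∀ i j → _⟶_ G i j → ¬ (w G i j ∈ℝ⁻)) →
    (∀ v (C : Walk G v v) → IsCycle G C → 2 ∣ len G C → wt G C ∈ℝ⁺) →
    (u v : Fin n) (γ₁ γ₂ : Walk G u v) → IsShortest G γ₁ → IsShortest G γ₂ →
    (wt G γ₁ /ℂ ∣ wt G γ₁ ∣ℂ ⟨ ∣wt∣#0 G γ₁ ⟩) ≈ℂ (wt G γ₂ /ℂ ∣ wt G γ₂ ∣ℂ ⟨ ∣wt∣#0 G γ₂ ⟩)
lemma2p3 n m _ _ G _ _ _ positive u v γ₁ γ₂ sh₁ sh₂ =
  normalised-≈ (wt G γ₁) (wt G γ₂) (∣wt∣#0 G γ₁) (∣wt∣#0 G γ₂)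
    (∈ℝ⁺-resp-≐ (wt G γ₁ *ℂ wt G (reverse G γ₂)) (wt G γ₁ *ℂ conj (wt G γ₂))
      (*ℂ-congˡ (wt G γ₁) (wt G (reverse G γ₂)) (conj (wt G γ₂)) (wt-reverse G γ₂))
      (shortest-product G positive γ₁ (reverse G γ₂) sh₁ (shortest-reverse G γ₂ sh₂) (<-wellFounded _)))
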